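{- Let $\xi(n,t)=(\xi_1(n,t),\xi_2(n,t),\xi_3(n,t),\xi_4(n,t))$, for integers $n\ge 0$, be given by the closed formulas in the context, and let $\zeta$ be the birational map on $X_4$ defined in the context. Then: 1. $\xi(0,t)=(t+1,t+2,t+3,t+4)$. 2. $\xi(1,t)=(2t^3+12t^2+19t+6,\ 2t^3+14t^2+31t+23,\ 2t^3+16t^2+41t+32,\ 2t^3+18t^2+49t+39)$. 3. For all $n\ge 0$, $\xi(n+2,t)=f(t)\,\xi(n+1,t)-\xi(n,t)$, where $f(t)=2t^2+10t+10$. 4. For each $n\ge 0$, $\xi(n,t)$ is a $4$-tuple of polynomials of degree $2n+1$ in the variable $t$. 5. For all $n\ge 0$ and $t\in\mathbb{Z}$, the sequence $\xi(n,t)$ is a Büchi sequence. 6. For all $n\ge 0$, $\zeta^{(n)}(t+1,t+2,t+3,t+4)=\xi(n,t)$ (with $t$ a variable, i.e. as an equality of points of $X_4$ over $\mathbb{Q}(t)$).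
   Context: A sequence $(x_1,\dots,x_\ell)$ of elements of a commutative ring $A$ with unit is a Büchi sequence over $A$ if $x_i^2-2x_{i+1}^2+x_{i+2}^2=2$ for each $i\in\{1,\dots,\ell-2\}$; here $A=\mathbb{Z}$ and $\ell=4$. Closed formulas. Let $t$ be a variable, $\alpha=\sqrt{(t+1)(t+2)(t+3)(t+4)}$ (in a quadratic extension of $\mathbb{Q}(t)$), $\beta=t^2+5t+5+\alpha$ and $\bar\beta=t^2+5t+5-\alpha$. For $n\ge0$, $$\xi_1(n,t)=\frac{(t^3+6t^2+9t+1+\alpha(t+1))\beta^n-(t^3+6t^2+9t+1-\alpha(t+1))\bar\beta^n}{2\alpha},$$ $$\xi_2(n,t)=\frac{(t^3+7t^2+16t+13+\alpha(t+2))\beta^n-(t^3+7t^2+16t+13-\alpha(t+2))\bar\beta^n}{2\alpha},$$ $$\xi_3(n,t)=\frac{(t^3+8t^2+21t+17+\alpha(t+3))\beta^n-(t^3+8t^2+21t+17-\alpha(t+3))\bar\beta^n}{2\alpha},$$ $$\xi_4(n,t)=\frac{(t^3+9t^2+24t+19+\alpha(t+4))\beta^n-(t^3+9t^2+24t+19-\alpha(t+4))\bar\beta^n}{2\alpha}.$$ For $t\in\mathbb{Z}$, $\xi(n,t)$ means the value at $t$ of the corresponding polynomials. $X_4$ is the affine variety over $\mathbb{Q}$ in coordinates $(x_1,x_2,x_3,x_4)$ defined by $x_4^2-2x_3^2+x_2^2=2$ and $x_3^2-2x_2^2+x_1^2=2$. Products of maps denote composition, and $\zeta^{(n)}$ is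 the $n$-fold composition of $\zeta$ with itself ($\zeta^{(0)}$ is the identity). Let $\tau(a,b,c,d)=(d,c,b,a)$ and $\mu_{14}(a,b,c,d)=(-a,b,c,-d)$. Let $\varphi=\left(\frac{p_1}{q},\frac{p_2}{q},\frac{p_3}{q},\frac{p_4}{q}\right)$, where, in the variables $(a,b,c,d)$, $$q=(b-c)^2(a-2b+c),$$ $$p_1=-2ab^3+ab^2c+2ab^2d+4abc^2-5abcd+ab-2ac^3+2ac^2d+ac-ad+3b^4-2b^3c-3b^3d-6b^2c^2+8b^2cd+b^2+4bc^3-4bc^2d-5bc+bd+c^2+cd-2,$$ $$p_2=-2ab^2c+5abc^2-2abcd+2ab-2ac^3+ac^2d-ad+3b^3c-8b^2c^2+3b^2cd-2b^2+4bc^3-2bc^2d-bc+2bd-2,$$ $$p_3=-2ab^3+5ab^2c-2ab^2d-2abc^2+abcd+3ab-ac-ad+3b^4-8b^3c+3b^3d+4b^2c^2-2b^2cd-3b^2-bc+3bd+c^2-cd-2,$$ $$p_4=-3ab^3+8ab^2c-3ab^2d-4abc^2+2abcd+4ab-2ac-ad+4b^4-10b^3c+4b^3d+2b^2c^2-2b^2cd-4b^2+5bc^3-2bc^2d-bc+4bd-2c^4+c^3d+2c^2-2cd-2.$$ Then $\varphi$ is a birational map on $X_4$, and $\zeta=\varphi\tau\mu_{14}$, i.e. $\zeta(a,b,c,d)=\varphi(-d,c,b,-a)$. -}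

module Defs where

open import Algebra.Bundles using (CommutativeRing)
open import Algebra.Bundles.Raw using (RawRing)
import Algebra.Definitions.RawSemiring as RawSemiringDefs
open import Data.Empty using (⊥-elim)
open import Data.Fin.Base using (Fin; toℕ)
open import Data.List.Base using (List; []; _∷_; map)
open import Data.Nat.Base using (ℕ; zero; suc; _<_)
open import Data.Product.Base using (Σ; _×_; _,_)
open import Data.Rational.Base as ℚ using (ℚ; 0ℚ; 1ℚ)
import Data.Rational.Properties as ℚ
open import Data.Sum.Base as Sum using (_⊎_; inj₁; inj₂)
open import Data.Unit.Base using (⊤)
open import Data.Vec.Base as Vec using (Vec; []; _∷_; lookup)
open import Data.Vec.Relation.Binary.Pointwise.Inductive using (Pointwise)
open import Level using (0ℓ; _⊔_)
open import Relation.Binary.PropositionalEquality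
open import Relation.Nullary using (¬_; yes; no)

-- The stdlib raw ring bundles provide neither subtraction nor numerals.
module Notation {c ℓ} (R : RawRing c ℓ) where
  open RawRing R public
  open RawSemiringDefs rawSemiring public using (_^_; _×′_)

  infixl 6 _-_
  _-_ : Carrier → Carrier → Carrier
  x - y = x + (- y)

  infix 9 #_
  #_ : ℕ → Carrier
  # n = n ×′ 1#

------------------------------------------------------------------------
-- Büchi sequences

module Büchi {c ℓ} (A : CommutativeRing c ℓ) where
  open Notation (CommutativeRing.rawRing A)

  -- i, j, k range over consecutive positions, so the condition is vacuous
  -- for sequences of length < 3.
  IsBüchi : ∀ {l} → Vec Carrier l → Set ℓ
  IsBüchi {l} x = (i j k : Fin l) → toℕ j ≡ suc (toℕ i) → toℕ k ≡ suc (toℕ j) →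
    lookup x i ^ 2 - # 2 * lookup x j ^ 2 + lookup x k ^ 2 ≈ # 2

------------------------------------------------------------------------
-- The variety X₄ and the polynomials defining φ

module _ {c ℓ} (R : RawRing c ℓ) where
  open Notation R

  InX₄ : Vec Carrier 4 → Set ℓ
  InX₄ (x₁ ∷ x₂ ∷ x₃ ∷ x₄ ∷ []) =
    x₄ ^ 2 - # 2 * x₃ ^ 2 + x₂ ^ 2 ≈ # 2 × x₃ ^ 2 - # 2 * x₂ ^ 2 + x₁ ^ 2 ≈ # 2

  q p₁ p₂ p₃ p₄ : Vec Carrier 4 → Carrier
  q  (a ∷ b ∷ c ∷ d ∷ []) = (b - c) ^ 2 * (a - # 2 * b + c)
  p₁ (a ∷ b ∷ c ∷ d ∷ []) =
    - # 2 * a * b ^ 3 + a * b ^ 2 * c + # 2 * a * b ^ 2 * d + # 4 * a * b * c ^ 2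
    - # 5 * a * b * c * d + a * b - # 2 * a * c ^ 3 + # 2 * a * c ^ 2 * d + a * c - a * d
    + # 3 * b ^ 4 - # 2 * b ^ 3 * c - # 3 * b ^ 3 * d - # 6 * b ^ 2 * c ^ 2
    + # 8 * b ^ 2 * c * d + b ^ 2 + # 4 * b * c ^ 3 - # 4 * b * c ^ 2 * d - # 5 * b * c
    + b * d + c ^ 2 + c * d - # 2
  p₂ (a ∷ b ∷ c ∷ d ∷ []) =
    - # 2 * a * b ^ 2 * c + # 5 * a * b * c ^ 2 - # 2 * a * b * c * d + # 2 * a * b
    - # 2 * a * c ^ 3 + a * c ^ 2 * d - a * d + # 3 * b ^ 3 * c - # 8 * b ^ 2 * c ^ 2
    + # 3 * b ^ 2 * c * d - # 2 * b ^ 2 + # 4 * b * c ^ 3 - # 2 * b * c ^ 2 * d - b * c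
    + # 2 * b * d - # 2
  p₃ (a ∷ b ∷ c ∷ d ∷ []) =
    - # 2 * a * b ^ 3 + # 5 * a * b ^ 2 * c - # 2 * a * b ^ 2 * d - # 2 * a * b * c ^ 2
    + a * b * c * d + # 3 * a * b - a * c - a * d + # 3 * b ^ 4 - # 8 * b ^ 3 * c
    + # 3 * b ^ 3 * d + # 4 * b ^ 2 * c ^ 2 - # 2 * b ^ 2 * c * d - # 3 * b ^ 2 - b * c
    + # 3 * b * d + c ^ 2 - c * d - # 2
  p₄ (a ∷ b ∷ c ∷ d ∷ []) =
    - # 3 * a * b ^ 3 + # 8 * a * b ^ 2 * c - # 3 * a * b ^ 2 * d - # 4 * a * b * c ^ 2
    + # 2 * a * b * c * d + # 4 * a * b - # 2 * a * c - a * d + # 4 * b ^ 4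
    - # 10 * b ^ 3 * c + # 4 * b ^ 3 * d + # 2 * b ^ 2 * c ^ 2 - # 2 * b ^ 2 * c * d
    - # 4 * b ^ 2 + # 5 * b * c ^ 3 - # 2 * b * c ^ 2 * d - b * c + # 4 * b * d
    - # 2 * c ^ 4 + c ^ 3 * d + # 2 * c ^ 2 - # 2 * c * d - # 2

------------------------------------------------------------------------
-- The polynomial ring ℚ[t]

-- Coefficient lists, constant term first.  Trailing zeros are allowed, so the
-- equality of polynomials is _≈ₚ_ and not _≡_.
ℚ[t] : Set
ℚ[t] = List ℚ

coeff : ℚ[t] → ℕ → ℚ
coeff []      k       = 0ℚ
coeff (a ∷ p) zero    = a
coeff (a ∷ p) (suc k) = coeff p k

infix 4 _≈ₚ_
record _≈ₚ_ (p q : ℚ[t]) : Set where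
  constructor mk≈ₚ
  field coeff≡ : ∀ k → coeff p k ≡ coeff q k

open _≈ₚ_ public

infixl 6 _+ₚ_
_+ₚ_ : ℚ[t] → ℚ[t] → ℚ[t]
[]      +ₚ q       = q
(a ∷ p) +ₚ []      = a ∷ p
(a ∷ p) +ₚ (b ∷ q) = (a ℚ.+ b) ∷ (p +ₚ q)

infixl 7 _*ₚ_
_*ₚ_ : ℚ[t] → ℚ[t] → ℚ[t]
[]      *ₚ q = []
(a ∷ p) *ₚ q = map (a ℚ.*_) q +ₚ (0ℚ ∷ p *ₚ q)

polynomialRing : RawRing 0ℓ 0ℓ
polynomialRing = record
  { Carrier = ℚ[t]
  ; _≈_     = _≈ₚ_
  ; _+_     = _+ₚ_
  ; _*_     = _*ₚ_
  ; -_      = map (λ a → ℚ.- a)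
  ; 0#      = []
  ; 1#      = 1ℚ ∷ []
  }

eval : ℚ[t] → ℚ → ℚ
eval []      x = 0ℚ
eval (a ∷ p) x = a ℚ.+ x ℚ.* eval p x

HasDegree : ℚ[t] → ℕ → Set
HasDegree p d = coeff p d ≢ 0ℚ × (∀ k → d < k → coeff p k ≡ 0ℚ)

coeff-scale : ∀ a q k → coeff (map (a ℚ.*_) q) k ≡ a ℚ.* coeff q k
coeff-scale a []      k       = sym (ℚ.*-zeroʳ a)
coeff-scale a (b ∷ q) zero    = refl
coeff-scale a (b ∷ q) (suc k) = coeff-scale a q k

coeff-+ : ∀ p q k → coeff (p +ₚ q) k ≡ coeff p k ℚ.+ coeff q k
coeff-+ []      q       k       = sym (ℚ.+-identityˡ (coeff q k))
coeff-+ (a ∷ p) []      k       = sym (ℚ.+-identityʳ (coeff (a ∷ p) k))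
coeff-+ (a ∷ p) (b ∷ q) zero    = refl
coeff-+ (a ∷ p) (b ∷ q) (suc k) = coeff-+ p q k

coeff-∷* : ∀ a p q k →
  coeff ((a ∷ p) *ₚ q) k ≡ a ℚ.* coeff q k ℚ.+ coeff (0ℚ ∷ p *ₚ q) k
coeff-∷* a p q k = trans (coeff-+ (map (a ℚ.*_) q) (0ℚ ∷ p *ₚ q) k)
  (cong (ℚ._+ coeff (0ℚ ∷ p *ₚ q) k) (coeff-scale a q k))

coeff-*∷0 : ∀ p q k → coeff (p *ₚ (0ℚ ∷ q)) (suc k) ≡ coeff (p *ₚ q) k
coeff-*∷0 []      q k = refl
coeff-*∷0 (a ∷ p) q k = trans (coeff-∷* a p (0ℚ ∷ q) (suc k))
  (trans (cong (a ℚ.* coeff q k ℚ.+_) (shift k)) (sym (coeff-∷* a p q k)))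
  where
  head≡0 : ∀ p → coeff (p *ₚ (0ℚ ∷ q)) 0 ≡ 0ℚ
  head≡0 []      = refl
  head≡0 (b ∷ r) = trans (coeff-∷* b r (0ℚ ∷ q) 0)
    (trans (ℚ.+-identityʳ (b ℚ.* 0ℚ)) (ℚ.*-zeroʳ b))

  shift : ∀ k → coeff (p *ₚ (0ℚ ∷ q)) k ≡ coeff (0ℚ ∷ p *ₚ q) k
  shift zero    = head≡0 p
  shift (suc k) = coeff-*∷0 p q k

ℚ-cancel : ∀ {a b} → a ≢ 0ℚ → a ℚ.* b ≡ 0ℚ → b ≡ 0ℚ
ℚ-cancel {a} {b} a≢0 ab≡0 = begin
  b                      ≡⟨ ℚ.*-identityˡ b ⟨
  1ℚ ℚ.* b               ≡⟨ cong (ℚ._* b) (ℚ.*-inverseˡ a) ⟨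
  (ℚ.1/ a ℚ.* a) ℚ.* b   ≡⟨ ℚ.*-assoc (ℚ.1/ a) a b ⟩
  ℚ.1/ a ℚ.* (a ℚ.* b)   ≡⟨ cong (ℚ.1/ a ℚ.*_) ab≡0 ⟩
  ℚ.1/ a ℚ.* 0ℚ          ≡⟨ ℚ.*-zeroʳ (ℚ.1/ a) ⟩
  0ℚ                     ∎
  where
  open ≡-Reasoning
  instance _ = ℚ.≢-nonZero a≢0

∷≈0 : ∀ {a p} → a ≡ 0ℚ → p ≈ₚ [] → (a ∷ p) ≈ₚ []
∷≈0 a≡0 p≈0 = mk≈ₚ λ { zero → a≡0 ; (suc k) → coeff≡ p≈0 k }

tailˡ : ∀ {a} p q → a ≡ 0ℚ → (a ∷ p) *ₚ q ≈ₚ [] → p *ₚ q ≈ₚ []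
tailˡ p q refl pq≈0 = mk≈ₚ λ k → begin
  r k                                      ≡⟨ ℚ.+-identityˡ (r k) ⟨
  0ℚ ℚ.+ r k                               ≡⟨ cong (ℚ._+ r k) (ℚ.*-zeroˡ (coeff q (suc k))) ⟨
  0ℚ ℚ.* coeff q (suc k) ℚ.+ r k           ≡⟨ coeff-∷* 0ℚ p q (suc k) ⟨
  coeff ((0ℚ ∷ p) *ₚ q) (suc k)            ≡⟨ coeff≡ pq≈0 (suc k) ⟩
  0ℚ                                       ∎
  where
  open ≡-Reasoning
  r = coeff (p *ₚ q)

tailʳ : ∀ {b} p q → b ≡ 0ℚ → p *ₚ (b ∷ q) ≈ₚ [] → p *ₚ q ≈ₚ []
tailʳ p q refl pq≈0 = mk≈ₚ λ k → trans (sym (coeff-*∷0 p q k)) (coeff≡ pq≈0 (suc k))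

domain-step : ∀ a p b q →
  (p *ₚ (b ∷ q) ≈ₚ [] → p ≈ₚ [] ⊎ (b ∷ q) ≈ₚ []) →
  ((a ∷ p) *ₚ q ≈ₚ [] → (a ∷ p) ≈ₚ [] ⊎ q ≈ₚ []) →
  (a ∷ p) *ₚ (b ∷ q) ≈ₚ [] → (a ∷ p) ≈ₚ [] ⊎ (b ∷ q) ≈ₚ []
domain-step a p b q ihˡ ihʳ pq≈0 with a ℚ.≟ 0ℚ
... | yes a≡0 = Sum.map₁ (∷≈0 a≡0) (ihˡ (tailˡ p (b ∷ q) a≡0 pq≈0))
... | no a≢0  = Sum.map₂ (∷≈0 b≡0) (ihʳ (tailʳ (a ∷ p) q b≡0 pq≈0))
  where
  b≡0 : b ≡ 0ℚ
  b≡0 = ℚ-cancel a≢0 (trans (sym (ℚ.+-identityʳ (a ℚ.* b))) (coeff≡ pq≈0 0))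

*ₚ-domain : ∀ p q → p *ₚ q ≈ₚ [] → p ≈ₚ [] ⊎ q ≈ₚ []
*ₚ-domain []      q       = λ _ → inj₁ (mk≈ₚ λ _ → refl)
*ₚ-domain (a ∷ p) []      = λ _ → inj₂ (mk≈ₚ λ _ → refl)
*ₚ-domain (a ∷ p) (b ∷ q) =
  domain-step a p b q (*ₚ-domain p (b ∷ q)) (*ₚ-domain (a ∷ p) q)

*ₚ-zeroˡ : ∀ p q → p ≈ₚ [] → p *ₚ q ≈ₚ []
*ₚ-zeroˡ []      q p≈0 = mk≈ₚ λ _ → refl
*ₚ-zeroˡ (a ∷ p) q p≈0 with coeff≡ p≈0 0
... | refl = mk≈ₚ λ k → trans (coeff-∷* 0ℚ p q k)
    (trans (cong₂ ℚ._+_ (ℚ.*-zeroˡ (coeff q k)) (rest k)) (ℚ.+-identityˡ 0ℚ))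
  where
  rest : ∀ k → coeff (0ℚ ∷ p *ₚ q) k ≡ 0ℚ
  rest zero    = refl
  rest (suc k) = coeff≡ (*ₚ-zeroˡ p q (mk≈ₚ λ j → coeff≡ p≈0 (suc j))) k

------------------------------------------------------------------------
-- The field ℚ(t) of rational functions

record ℚ⟨t⟩ : Set where
  constructor mkFrac
  field
    num   : ℚ[t]
    den   : ℚ[t]
    den≉0 : ¬ (den ≈ₚ [])

open ℚ⟨t⟩ public

infix 4 _≈ₖ_
record _≈ₖ_ (x y : ℚ⟨t⟩) : Set where
  constructor mk≈ₖ
  field cross : num x *ₚ den y ≈ₚ num y *ₚ den x

open _≈ₖ_ public

den*den≉0 : ∀ x y → ¬ (den x *ₚ den y ≈ₚ [])
den*den≉0 x y eq = Sum.[ den≉0 x , den≉0 y ] (*ₚ-domain (den x) (den y) eq)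

fromPoly : ℚ[t] → ℚ⟨t⟩
fromPoly p = mkFrac p (1ℚ ∷ []) λ eq → ⊥-elim (1≢0 (coeff≡ eq 0))
  where
  1≢0 : 1ℚ ≢ 0ℚ
  1≢0 ()

functionField : RawRing 0ℓ 0ℓ
functionField = record
  { Carrier = ℚ⟨t⟩
  ; _≈_     = _≈ₖ_
  ; _+_     = λ x y → mkFrac (num x *ₚ den y +ₚ num y *ₚ den x) (den x *ₚ den y) (den*den≉0 x y)
  ; _*_     = λ x y → mkFrac (num x *ₚ num y) (den x *ₚ den y) (den*den≉0 x y)
  ; -_      = λ x → mkFrac (map (λ a → ℚ.- a) (num x)) (den x) (den≉0 x)
  ; 0#      = fromPoly []
  ; 1#      = fromPoly (1ℚ ∷ [])
  }

module K = Notation functionField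

recipₖ : (x : ℚ⟨t⟩) → x K.≉ K.0# → ℚ⟨t⟩
recipₖ x x≉0 = mkFrac (den x) (num x) λ num≈0 → x≉0 (mk≈ₖ (*ₚ-zeroˡ (num x) (1ℚ ∷ []) num≈0))

divₖ : (x y : ℚ⟨t⟩) → y K.≉ K.0# → ℚ⟨t⟩
divₖ x y y≉0 = x K.* recipₖ y y≉0

tₖ : ℚ⟨t⟩
tₖ = fromPoly (0ℚ ∷ 1ℚ ∷ [])

------------------------------------------------------------------------
-- The quadratic extension ℚ(t)(α)

α² : ℚ⟨t⟩
α² = (tₖ + # 1) * (tₖ + # 2) * (tₖ + # 3) * (tₖ + # 4)
  where open K

-- mkQuad u v stands for u + v α; the ring is ℚ(t)[X] / (X² - α²).
record ℚ⟨t,α⟩ : Set where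
  constructor mkQuad
  field
    re : ℚ⟨t⟩
    im : ℚ⟨t⟩

open ℚ⟨t,α⟩ public

record _≈ₗ_ (x y : ℚ⟨t,α⟩) : Set where
  constructor mk≈ₗ
  field
    re≈ : re x ≈ₖ re y
    im≈ : im x ≈ₖ im y

open _≈ₗ_ public

quadraticExtension : RawRing 0ℓ 0ℓ
quadraticExtension = record
  { Carrier = ℚ⟨t,α⟩
  ; _≈_     = _≈ₗ_
  ; _+_     = λ x y → mkQuad (re x + re y) (im x + im y)
  ; _*_     = λ x y → mkQuad (re x * re y + α² * (im x * im y)) (re x * im y + im x * re y)
  ; -_      = λ x → mkQuad (- re x) (- im x)
  ; 0#      = mkQuad 0# 0#
  ; 1#      = mkQuad 1# 0#
  }
  where open K

open Notation quadraticExtension public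

fromK : ℚ⟨t⟩ → ℚ⟨t,α⟩
fromK x = mkQuad x K.0#

t α : ℚ⟨t,α⟩
t = fromK tₖ
α = mkQuad K.0# K.1#

norm : ℚ⟨t,α⟩ → ℚ⟨t⟩
norm x = re x K.* re x K.- α² K.* (im x K.* im x)

-- x / y, via 1 / y = (re y - (im y) α) / norm y.
divₗ : (x y : ℚ⟨t,α⟩) → norm y K.≉ K.0# → ℚ⟨t,α⟩
divₗ x y h = x * mkQuad (re y) (K.- im y) * fromK (recipₖ (norm y) h)

-- The numerator of norm (2α) has nonzero constant coefficient.
norm2α≉0 : norm (# 2 * α) K.≉ K.0#
norm2α≉0 eq with () ← coeff≡ (cross eq) 0

------------------------------------------------------------------------
-- The closed formulas

β β̄ : ℚ⟨t,α⟩
β = t ^ 2 + # 5 * t + # 5 + α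
β̄ = t ^ 2 + # 5 * t + # 5 - α

closedForm : (A B : ℚ⟨t,α⟩) → ℕ → ℚ⟨t,α⟩
closedForm A B n = divₗ ((A + α * B) * β ^ n - (A - α * B) * β̄ ^ n) (# 2 * α) norm2α≉0

ξ₁ ξ₂ ξ₃ ξ₄ : ℕ → ℚ⟨t,α⟩
ξ₁ = closedForm (t ^ 3 + # 6 * t ^ 2 + # 9 * t + # 1)   (t + # 1)
ξ₂ = closedForm (t ^ 3 + # 7 * t ^ 2 + # 16 * t + # 13) (t + # 2)
ξ₃ = closedForm (t ^ 3 + # 8 * t ^ 2 + # 21 * t + # 17) (t + # 3)
ξ₄ = closedForm (t ^ 3 + # 9 * t ^ 2 + # 24 * t + # 19) (t + # 4)

ξ : ℕ → Vec ℚ⟨t,α⟩ 4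
ξ n = ξ₁ n ∷ ξ₂ n ∷ ξ₃ n ∷ ξ₄ n ∷ []

infix 4 _≋_
_≋_ : ∀ {n} → Vec ℚ⟨t,α⟩ n → Vec ℚ⟨t,α⟩ n → Set
_≋_ = Pointwise _≈_

IsPolyTuple : ∀ {n} → Vec ℚ⟨t,α⟩ n → Vec ℚ[t] n → Set
IsPolyTuple x p = x ≋ Vec.map (λ r → fromK (fromPoly r)) p

------------------------------------------------------------------------
-- Partial maps and ζ

record PartialMap (A : Set) : Set₁ where
  field
    Dom   : A → Set
    apply : (x : A) → Dom x → A

open PartialMap public

total : ∀ {A} → (A → A) → PartialMap A
total f = record { Dom = λ _ → ⊤ ; apply = λ x _ → f x }

infixr 9 _∘ₚ_
_∘ₚ_ : ∀ {A} → PartialMap A → PartialMap A → PartialMap A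
g ∘ₚ f = record
  { Dom   = λ x → Σ (Dom f x) λ h → Dom g (apply f x h)
  ; apply = λ { x (h , h′) → apply g (apply f x h) h′ }
  }

iterate : ∀ {A} → PartialMap A → ℕ → PartialMap A
iterate f zero    = total λ x → x
iterate f (suc n) = f ∘ₚ iterate f n

-- A birational map acts on the ℚ(t)-points of X₄ as a partial map: φ is defined
-- at the points of X₄ where the denominator q does not vanish.  The ambient
-- type is affine 4-space, so that a value lying on X₄ is a separate assertion.
Point : Set
Point = Vec ℚ⟨t⟩ 4

X₄ : Point → Set
X₄ = InX₄ functionField

φ τ μ₁₄ ζ : PartialMap Point
φ = record
  { Dom   = λ P → X₄ P × Q P K.≉ K.0#
  ; apply = λ { P (_ , h) →
      divₖ (p₁ functionField P) (Q P) h ∷ divₖ (p₂ functionField P) (Q P) h ∷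
      divₖ (p₃ functionField P) (Q P) h ∷ divₖ (p₄ functionField P) (Q P) h ∷ [] }
  }
  where
  Q : Point → ℚ⟨t⟩
  Q = q functionField
τ   = total λ { (a ∷ b ∷ c ∷ d ∷ []) → d ∷ c ∷ b ∷ a ∷ [] }
μ₁₄ = total λ { (a ∷ b ∷ c ∷ d ∷ []) → K.- a ∷ b ∷ c ∷ K.- d ∷ [] }
ζ   = φ ∘ₚ τ ∘ₚ μ₁₄

-- The point (t+1, t+2, t+3, t+4) of X₄ over ℚ(t).
P₀ : Point
P₀ = tₖ K.+ K.# 1 ∷ tₖ K.+ K.# 2 ∷ tₖ K.+ K.# 3 ∷ tₖ K.+ K.# 4 ∷ []

-- Put T = t² + 5t + 5.  Since T² − α² = 1, the conjugates β and β̄ = 1/β are the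
-- roots of X² − 2T X + 1, so βⁿ = (u (n+1) − T u n) + u n α, where u 0 = 0, u 1 = 1 and
-- u (n+2) = 2T u (n+1) − u n.  Substituting this into the closed formulas gives
--   ξ n = u (n+1) B + u n C,  B = (t+1, t+2, t+3, t+4),  C = (−(t+4), t+3, t+2, −(t+1)),
-- where (x, y) = (u n, u (n+1)) lies on the conic x² − 2T x y + y² = 1.  Everything
-- follows from identities between points x B + y C modulo the equation of the conic:
-- they lie on X₄, the map (a, b, c, d) ↦ (−d, c, b, −a) exchanges B and C, and φ sends
-- x B + y C to (2T y − x) B + y C.  Leading coefficients show that q does not vanish.

module Submission where

open import Algebra.Bundles using (CommutativeRing)
open import Algebra.Bundles.Raw using (RawRing)
import Algebra.Definitions as AlgebraDefinitions
import Algebra.Definitions.RawSemiring as RawSemiringDefs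
open import Algebra.Morphism.Structures using (module RingMorphisms)
import Algebra.Properties.AbelianGroup as AbelianGroupProperties
import Algebra.Properties.CommutativeSemigroup as CommutativeSemigroupProperties
import Algebra.Properties.Group as GroupProperties
import Algebra.Properties.Ring as RingProperties
import Algebra.Properties.Semiring.Exp as Exp
import Algebra.Properties.Semiring.Exp.TCOptimised as ExpTCOptimised
import Algebra.Properties.Semiring.Mult.TCOptimised as Mult
open import Data.Bool.Base as Bool using (Bool; true; false)
open import Data.Fin.Base using (zero; suc)
open import Data.Integer.Base as ℤ using (ℤ; +_; -[1+_])
import Data.Integer.Properties as ℤ
open import Data.List.Base using ([]; _∷_; map)
open import Data.Maybe.Base using (nothing)
open import Data.Nat.Base as ℕ using (ℕ; zero; suc; s≤s)
import Data.Nat.Properties as ℕ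
open import Data.Product.Base using (Σ; ∃; _×_; _,_; proj₁; proj₂)
open import Data.Rational.Base as ℚ using (ℚ; 0ℚ; 1ℚ)
import Data.Rational.Properties as ℚ
import Data.Rational.Unnormalised.Base as ℚᵘ
import Data.Rational.Unnormalised.Properties as ℚᵘ
open import Data.Sum.Base using ([_,_]′)
open import Data.Unit.Base using (tt)
open import Data.Vec.Base as Vec using (Vec; []; _∷_; lookup)
open import Data.Vec.N-ary using (N-ary; Eq; curryⁿ; curryⁿ-cong)
open import Data.Vec.Relation.Binary.Pointwise.Inductive using (Pointwise; []; _∷_)
open import Data.Vec.Relation.Unary.All using ([]; _∷_)
open import Function.Base using (_∘_)
open import Level using (0ℓ)
open import Relation.Binary.PropositionalEquality as ≡ using (_≡_; _≢_; cong; cong₂; module ≡-Reasoning)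
import Relation.Binary.Reasoning.Setoid as SetoidReasoning
import Relation.Binary.Reflection as Reflection
open import Relation.Binary.Structures using (IsEquivalence)
open import Relation.Nullary using (¬_; contradiction)
import Tactic.RingSolver.Core.AlmostCommutativeRing as Almost
open import Tactic.RingSolver.Core.Expression using (Expr; Κ; Ι; _⊕_; _⊗_; _⊛_; ⊝_; module Eval)
import Tactic.RingSolver.Core.Polynomial.Base as Normal
import Tactic.RingSolver.Core.Polynomial.Homomorphism as NormalHomomorphism
open import Tactic.RingSolver.Core.Polynomial.Parameters using (Homomorphism)
import Tactic.RingSolver.Core.Polynomial.Semantics as NormalSemantics
open import Defs using (module Notation; module Büchi; InX₄; q; p₁; p₂; p₃; p₄;
  ℚ[t]; coeff; _≈ₚ_; mk≈ₚ; coeff≡; _+ₚ_; _*ₚ_; polynomialRing; eval; HasDegree;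
  coeff-scale; coeff-+; coeff-∷*; ℚ-cancel; *ₚ-domain;
  num; den; den≉0; _≈ₖ_; mk≈ₖ; cross; functionField; fromPoly; recipₖ; divₖ; tₖ; α²;
  ℚ⟨t,α⟩; mkQuad; re; im; _≈ₗ_; mk≈ₗ; re≈; im≈; quadraticExtension; fromK; norm; divₗ; α;
  Point; X₄; Dom; apply; iterate; φ; ζ; P₀)

-- The claims live in different rings: the closed formulas in ℚ(t)(α), the iterates of ζ in ℚ(t),
-- degrees and the nonvanishing of `q` in ℚ[t], Büchi values in ℤ. The sequence `u` and the
-- coordinates of ξ are therefore kept as terms in one variable with integer coefficients. A term
-- can be evaluated in each of these rings, and its values correspond under the homomorphisms ℚ[t] →
-- ℚ(t) → ℚ(t)(α), ℚ[t] → ℚ and ℤ → ℚ. The identities hold in an arbitrary commutative ring and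
-- avoid division: the one for φ reads pᵢ = q times the new coordinate, and the quotient is taken
-- only in ℚ(t). Why ζ shifts the index by one: for fixed y the conic is a quadratic equation in x
-- whose roots have sum 2T y, and φ replaces x by the other root. This alone is an involution of the
-- conic. Preceded by the exchange of B and C, it sends the coefficients (u (n+1), u n) to (u n, u
-- (n+1)) and then to (u (n+2), u (n+1)).

-- Terms with integer coefficients and a solver for ring identities

Term : ℕ → Set
Term = Expr ℤ

-- Ring-generic definitions such as `q` or `span`, instantiated here, become syntax. Evaluating that
-- syntax in a ring gives back the instance at the ring by unfolding, because `fromℤ (+ 0)` and
-- `fromℤ (+ 1)` reduce to `0#` and `1#`, and powers and numerals are built from these in the same
-- way everywhere.
termRing : ℕ → RawRing 0ℓ 0ℓ
termRing n = record
  { Carrier = Term n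
  ; _≈_     = _≡_
  ; _+_     = _⊕_
  ; _*_     = _⊗_
  ; -_      = ⊝_
  ; 0#      = Κ (+ 0)
  ; 1#      = Κ (+ 1)
  }

module IntegerCoefficients {c ℓ} (R : CommutativeRing c ℓ) where
  open CommutativeRing R
  open Notation rawRing using (#_; _^_) renaming (_-_ to _∸_)
  open RingProperties ring
  open AbelianGroupProperties +-abelianGroup using (⁻¹-∙-comm)
  open Mult semiring using (×-homo-+; ×1-homo-*; 1+×)
  open SetoidReasoning setoid

  fromℤ : ℤ → Carrier
  fromℤ (+ n)    = # n
  fromℤ -[1+ n ] = - # (suc n)

  ⊖-homo : ∀ m n → fromℤ (m ℤ.⊖ n) ≈ # m ∸ # n
  ⊖-homo m zero          = sym (trans (+-congˡ -0#≈0#) (+-identityʳ (# m)))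
  ⊖-homo zero (suc n)    = sym (+-identityˡ (- # (suc n)))
  ⊖-homo (suc m) (suc n) = begin
    fromℤ (suc m ℤ.⊖ suc n)        ≡⟨ ≡.cong fromℤ (ℤ.[1+m]⊖[1+n]≡m⊖n m n) ⟩
    fromℤ (m ℤ.⊖ n)                ≈⟨ ⊖-homo m n ⟩
    -- A zero `1# ∸ 1#` is inserted, and its halves restore the successors cancelled from both
    -- arguments.
    # m ∸ # n                      ≈⟨ +-congʳ (+-identityˡ (# m)) ⟨
    (0# + # m) ∸ # n               ≈⟨ +-congʳ (+-congʳ (-‿inverseʳ 1#)) ⟨
    ((1# ∸ 1#) + # m) ∸ # n        ≈⟨ +-congʳ (+-assoc 1# (- 1#) (# m)) ⟩
    (1# + (- 1# + # m)) ∸ # n      ≈⟨ +-congʳ (+-congˡ (+-comm (- 1#) (# m))) ⟩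
    (1# + (# m ∸ 1#)) ∸ # n        ≈⟨ +-congʳ (+-assoc 1# (# m) (- 1#)) ⟨
    ((1# + # m) ∸ 1#) ∸ # n        ≈⟨ +-assoc (1# + # m) (- 1#) (- # n) ⟩
    (1# + # m) + (- 1# ∸ # n)      ≈⟨ +-congˡ (⁻¹-∙-comm 1# (# n)) ⟩
    (1# + # m) ∸ (1# + # n)        ≈⟨ +-cong (1+× m 1#) (-‿cong (1+× n 1#)) ⟨
    # (suc m) ∸ # (suc n)          ∎

  -‿homo : ∀ i → fromℤ (ℤ.- i) ≈ - fromℤ i
  -‿homo (+ zero)  = sym -0#≈0#
  -‿homo (+ suc n) = refl
  -‿homo -[1+ n ]  = sym (-‿involutive (# (suc n)))

  +-homo : ∀ i j → fromℤ (i ℤ.+ j) ≈ fromℤ i + fromℤ j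
  +-homo (+ m)    (+ n)    = ×-homo-+ 1# m n
  +-homo (+ m)    -[1+ n ] = ⊖-homo m (suc n)
  +-homo -[1+ m ] (+ n)    = trans (⊖-homo n (suc m)) (+-comm (# n) (- # (suc m)))
  +-homo -[1+ m ] -[1+ n ] = begin
    - # (suc (suc (m ℕ.+ n)))      ≡⟨ ≡.cong (λ k → - # (suc k)) (≡.sym (ℕ.+-suc m n)) ⟩
    - # (suc m ℕ.+ suc n)          ≈⟨ -‿cong (×-homo-+ 1# (suc m) (suc n)) ⟩
    - (# (suc m) + # (suc n))      ≈⟨ ⁻¹-∙-comm (# (suc m)) (# (suc n)) ⟨
    - # (suc m) ∸ # (suc n)        ∎

  *-homo⁺ : ∀ m j → fromℤ (+ m ℤ.* j) ≈ # m * fromℤ j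
  *-homo⁺ m (+ n)    = trans (reflexive (≡.cong fromℤ (≡.sym (ℤ.pos-* m n)))) (×1-homo-* m n)
  *-homo⁺ m -[1+ n ] = begin
    fromℤ (+ m ℤ.* -[1+ n ])          ≡⟨ ≡.cong fromℤ (ℤ.neg-distribʳ-* (+ m) (+ suc n)) ⟨
    fromℤ (ℤ.- (+ m ℤ.* + suc n))     ≈⟨ -‿homo (+ m ℤ.* + suc n) ⟩
    - fromℤ (+ m ℤ.* + suc n)         ≈⟨ -‿cong (*-homo⁺ m (+ suc n)) ⟩
    - (# m * # (suc n))               ≈⟨ -‿distribʳ-* (# m) (# (suc n)) ⟩
    # m * - # (suc n)                 ∎

  *-homo : ∀ i j → fromℤ (i ℤ.* j) ≈ fromℤ i * fromℤ j
  *-homo (+ m)    j = *-homo⁺ m j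
  *-homo -[1+ m ] j = begin
    fromℤ (-[1+ m ] ℤ.* j)          ≡⟨ ≡.cong fromℤ (ℤ.neg-distribˡ-* (+ suc m) j) ⟨
    fromℤ (ℤ.- (+ suc m ℤ.* j))     ≈⟨ -‿homo (+ suc m ℤ.* j) ⟩
    - fromℤ (+ suc m ℤ.* j)         ≈⟨ -‿cong (*-homo⁺ (suc m) j) ⟩
    - (# (suc m) * fromℤ j)         ≈⟨ -‿distribˡ-* (# (suc m)) (fromℤ j) ⟩
    - # (suc m) * fromℤ j           ∎

module Solver {c ℓ} (R : CommutativeRing c ℓ) where
  open CommutativeRing R
  open IntegerCoefficients R
  open Eval rawRing fromℤ public

  private
    -- Zero is recognised among the integer coefficients only, so normal forms compute in the same
    -- way whatever the ring is.
    isZero : ℤ → Bool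
    isZero (+ 0) = true
    isZero _     = false

    homomorphism : Homomorphism 0ℓ 0ℓ c ℓ
    homomorphism = record
      { from = record
        { rawRing = CommutativeRing.rawRing ℤ.+-*-commutativeRing
        ; isZero  = isZero
        }
      ; to = Almost.fromCommutativeRing R (λ _ → nothing)
      ; morphism = record
        { ⟦_⟧    = fromℤ
        ; +-homo = +-homo
        ; *-homo = *-homo
        ; -‿homo = -‿homo
        ; 0-homo = refl
        ; 1-homo = refl
        }
      ; Zero-C⟶Zero-R = zero-homo
      }
      where
      zero-homo : ∀ i → Bool.T (isZero i) → 0# ≈ fromℤ i
      zero-homo (+ 0) _ = refl

    open Normal (Homomorphism.from homomorphism)
    open NormalHomomorphism homomorphism
    module Semantics = NormalSemantics homomorphism
    open ExpTCOptimised semiring using (^-congˡ)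

  normalise : ∀ {n} → Term n → Poly n
  normalise (Κ i)   = κ i
  normalise (Ι x)   = ι x
  normalise (x ⊕ y) = normalise x ⊞ normalise y
  normalise (x ⊗ y) = normalise x ⊠ normalise y
  normalise (⊝ x)   = ⊟ normalise x
  normalise (x ⊛ i) = normalise x ⊡ i

  normalise-correct : ∀ {n} (e : Term n) ρ → Semantics.⟦ normalise e ⟧ ρ ≈ ⟦ e ⟧ ρ
  normalise-correct (Κ i)   ρ = κ-hom i ρ
  normalise-correct (Ι x)   ρ = ι-hom x ρ
  normalise-correct (x ⊕ y) ρ = trans (⊞-hom (normalise x) (normalise y) ρ) (+-cong (normalise-correct x ρ) (normalise-correct y ρ))
  normalise-correct (x ⊗ y) ρ = trans (⊠-hom (normalise x) (normalise y) ρ) (*-cong (normalise-correct x ρ) (normalise-correct y ρ))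
  normalise-correct (⊝ x)   ρ = trans (⊟-hom (normalise x) ρ) (-‿cong (normalise-correct x ρ))
  normalise-correct (x ⊛ i) ρ = trans (⊡-hom (normalise x) i ρ) (^-congˡ i (normalise-correct x ρ))

  open Reflection setoid Ι ⟦_⟧ (λ e → Semantics.⟦ normalise e ⟧) normalise-correct public using (close)

  -- The two normal forms are compared as syntax over ℤ, so `≡.refl` settles the hypothesis without
  -- evaluating any element of the ring.
  solve : ∀ n (f : N-ary n (Term n) (Term n × Term n)) →
    normalise (proj₁ (close n f)) ≡ normalise (proj₂ (close n f)) →
    Eq n _≈_ (curryⁿ ⟦ proj₁ (close n f) ⟧) (curryⁿ ⟦ proj₂ (close n f) ⟧)
  solve n f eq = curryⁿ-cong _≈_ ⟦ e₁ ⟧ ⟦ e₂ ⟧ λ ρ →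
    trans (sym (normalise-correct e₁ ρ))
      (trans (reflexive (≡.cong (λ p → Semantics.⟦ p ⟧ ρ) eq)) (normalise-correct e₂ ρ))
    where
    e₁ e₂ : Term n
    e₁ = proj₁ (close n f)
    e₂ = proj₂ (close n f)

-- Commutative rings and ring homomorphisms from short lists of laws

module _ {c ℓ} (R : RawRing c ℓ) where
  open RawRing R
  open AlgebraDefinitions _≈_

  buildCommutativeRing : IsEquivalence _≈_ →
    Congruent₂ _+_ → Associative _+_ → Commutative _+_ → LeftIdentity 0# _+_ →
    Congruent₁ (-_) → LeftInverse 0# (-_) _+_ →
    Congruent₂ _*_ → Associative _*_ → Commutative _*_ → LeftIdentity 1# _*_ →
    _DistributesOverʳ_ _*_ _+_ → CommutativeRing c ℓ
  buildCommutativeRing isEquivalence +-cong +-assoc +-comm +-identityˡ -‿cong -‿inverseˡ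
    *-cong *-assoc *-comm *-identityˡ distribʳ = record
    { isCommutativeRing = record
      { isRing = record
        { +-isAbelianGroup = record
          { isGroup = record
            { isMonoid = record
              { isSemigroup = record
                { isMagma = record { isEquivalence = isEquivalence ; ∙-cong = +-cong }
                ; assoc   = +-assoc
                }
              ; identity = +-identityˡ , λ x → trans (+-comm x 0#) (+-identityˡ x)
              }
            ; inverse = -‿inverseˡ , λ x → trans (+-comm x (- x)) (-‿inverseˡ x)
            ; ⁻¹-cong = -‿cong
            }
          ; comm = +-comm
          }
        ; *-cong     = *-cong
        ; *-assoc    = *-assoc
        ; *-identity = *-identityˡ , λ x → trans (*-comm x 1#) (*-identityˡ x)
        ; distrib    = (λ x y z → trans (*-comm x (y + z))
            (trans (distribʳ x y z) (+-cong (*-comm y x) (*-comm z x)))) , distribʳ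
        }
      ; *-comm = *-comm
      }
    }
    where open IsEquivalence isEquivalence

module _ {c₁ ℓ₁ c₂ ℓ₂} (R : RawRing c₁ ℓ₁) (S : RawRing c₂ ℓ₂) where
  private
    module R = RawRing R
    module S = RawRing S
  open RingMorphisms R S

  buildHomomorphism : (f : R.Carrier → S.Carrier) →
    (∀ {x y} → x R.≈ y → f x S.≈ f y) →
    (∀ x y → f (x R.+ y) S.≈ (f x S.+ f y)) →
    (∀ x y → f (x R.* y) S.≈ (f x S.* f y)) →
    (∀ x → f (R.- x) S.≈ (S.- f x)) →
    f R.0# S.≈ S.0# → f R.1# S.≈ S.1# → IsRingHomomorphism f
  buildHomomorphism f cong +-homo *-homo -‿homo 0#-homo 1#-homo = record
    { isSemiringHomomorphism = record
      { isNearSemiringHomomorphism = record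
        { +-isMonoidHomomorphism = record
          { isMagmaHomomorphism = record
            { isRelHomomorphism = record { cong = cong }
            ; homo              = +-homo
            }
          ; ε-homo = 0#-homo
          }
        ; *-homo = *-homo
        }
      ; 1#-homo = 1#-homo
      }
    ; -‿homo = -‿homo
    }

-- Term values under ring homomorphisms

module Transport {c₁ ℓ₁ c₂ ℓ₂} (R : CommutativeRing c₁ ℓ₁) (S : CommutativeRing c₂ ℓ₂) where
  private
    module R = CommutativeRing R
    module S = CommutativeRing S
    module ⟦R⟧ = Solver R
    module ⟦S⟧ = Solver S
    module NR = Notation R.rawRing
    module NS = Notation S.rawRing
  open RingMorphisms R.rawRing S.rawRing
  open RawSemiringDefs NR.rawSemiring using () renaming (_^′_ to _^R_)
  open RawSemiringDefs NS.rawSemiring using () renaming (_^′_ to _^S_)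

  module _ {f : R.Carrier → S.Carrier} (isHom : IsRingHomomorphism f) where
    open IsRingHomomorphism isHom

    #-homo : ∀ n → f (NR.# n) S.≈ NS.# n
    #-homo 0             = 0#-homo
    #-homo 1             = 1#-homo
    #-homo (suc (suc n)) = S.trans (+-homo _ _) (S.+-cong (#-homo (suc n)) 1#-homo)

    fromℤ-homo : ∀ i → f (IntegerCoefficients.fromℤ R i) S.≈ IntegerCoefficients.fromℤ S i
    fromℤ-homo (+ n)    = #-homo n
    fromℤ-homo -[1+ n ] = S.trans (-‿homo _) (S.-‿cong (#-homo (suc n)))

    ^-homo : ∀ {x y} → f x S.≈ y → ∀ n → f (x ^R n) S.≈ y ^S n
    ^-homo x≈y 0             = 1#-homo
    ^-homo x≈y 1             = x≈y
    ^-homo x≈y (suc (suc n)) = S.trans (*-homo _ _) (S.*-cong (^-homo x≈y (suc n)) x≈y)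

    -- Every passage between two rings in the proof rests on this induction over terms.
    ⟦⟧-homo : ∀ {n} {ρ : Vec R.Carrier n} {σ} → (∀ i → f (lookup ρ i) S.≈ lookup σ i) →
      ∀ e → f (⟦R⟧.⟦ e ⟧ ρ) S.≈ ⟦S⟧.⟦ e ⟧ σ
    ⟦⟧-homo ρ≈σ (Κ i)   = fromℤ-homo i
    ⟦⟧-homo ρ≈σ (Ι x)   = ρ≈σ x
    ⟦⟧-homo ρ≈σ (x ⊕ y) = S.trans (+-homo _ _) (S.+-cong (⟦⟧-homo ρ≈σ x) (⟦⟧-homo ρ≈σ y))
    ⟦⟧-homo ρ≈σ (x ⊗ y) = S.trans (*-homo _ _) (S.*-cong (⟦⟧-homo ρ≈σ x) (⟦⟧-homo ρ≈σ y))
    ⟦⟧-homo ρ≈σ (x ⊛ n) = ^-homo (⟦⟧-homo ρ≈σ x) n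
    ⟦⟧-homo ρ≈σ (⊝ x)   = S.trans (-‿homo _) (S.-‿cong (⟦⟧-homo ρ≈σ x))

    private
      coordinates : Vec (Term 4) 4
      coordinates = Ι zero ∷ Ι (suc zero) ∷ Ι (suc (suc zero)) ∷ Ι (suc (suc (suc zero))) ∷ []

      image : ∀ {n} (x : Vec R.Carrier n) (y : Vec S.Carrier n) → Pointwise S._≈_ y (Vec.map f x) →
        ∀ i → f (lookup x i) S.≈ lookup y i
      image (_ ∷ _) (_ ∷ _) (y≈fx ∷ _) zero    = S.sym y≈fx
      image (_ ∷ x) (_ ∷ y) (_ ∷ y≈fx) (suc i) = image x y y≈fx i

      term-homo : ∀ x y → Pointwise S._≈_ y (Vec.map f x) → (e : Term 4) →
        Solver.⟦_⟧ S e y S.≈ f (Solver.⟦_⟧ R e x)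
      term-homo x y y≈fx e = S.sym (⟦⟧-homo {ρ = x} {σ = y} (image x y y≈fx) e)

    -- The point `y` is tied to the image of `x` only up to the equality of `S`, since iterates of ζ
    -- are fractions in unreduced form. Matching on four entries lets the evaluated term unfold to
    -- `q`.
    q-homo : ∀ x y → Pointwise S._≈_ y (Vec.map f x) → q S.rawRing y S.≈ f (q R.rawRing x)
    q-homo x@(_ ∷ _ ∷ _ ∷ _ ∷ []) y@(_ ∷ _ ∷ _ ∷ _ ∷ []) y≈fx =
      term-homo x y y≈fx (q (termRing 4) coordinates)

    p₁-homo : ∀ x y → Pointwise S._≈_ y (Vec.map f x) → p₁ S.rawRing y S.≈ f (p₁ R.rawRing x)
    p₁-homo x@(_ ∷ _ ∷ _ ∷ _ ∷ []) y@(_ ∷ _ ∷ _ ∷ _ ∷ []) y≈fx =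
      term-homo x y y≈fx (p₁ (termRing 4) coordinates)

    p₂-homo : ∀ x y → Pointwise S._≈_ y (Vec.map f x) → p₂ S.rawRing y S.≈ f (p₂ R.rawRing x)
    p₂-homo x@(_ ∷ _ ∷ _ ∷ _ ∷ []) y@(_ ∷ _ ∷ _ ∷ _ ∷ []) y≈fx =
      term-homo x y y≈fx (p₂ (termRing 4) coordinates)

    p₃-homo : ∀ x y → Pointwise S._≈_ y (Vec.map f x) → p₃ S.rawRing y S.≈ f (p₃ R.rawRing x)
    p₃-homo x@(_ ∷ _ ∷ _ ∷ _ ∷ []) y@(_ ∷ _ ∷ _ ∷ _ ∷ []) y≈fx =
      term-homo x y y≈fx (p₃ (termRing 4) coordinates)

    p₄-homo : ∀ x y → Pointwise S._≈_ y (Vec.map f x) → p₄ S.rawRing y S.≈ f (p₄ R.rawRing x)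
    p₄-homo x@(_ ∷ _ ∷ _ ∷ _ ∷ []) y@(_ ∷ _ ∷ _ ∷ _ ∷ []) y≈fx =
      term-homo x y y≈fx (p₄ (termRing 4) coordinates)

    InX₄-homo : ∀ x y → Pointwise S._≈_ y (Vec.map f x) → InX₄ R.rawRing x → InX₄ S.rawRing y
    InX₄-homo x@(_ ∷ _ ∷ _ ∷ _ ∷ []) y@(_ ∷ _ ∷ _ ∷ _ ∷ []) y≈fx (eq₁ , eq₂) =
      transfer (x₄ ^ 2 - # 2 * x₃ ^ 2 + x₂ ^ 2) eq₁ , transfer (x₃ ^ 2 - # 2 * x₂ ^ 2 + x₁ ^ 2) eq₂
      where
      open Notation (termRing 4)
      x₁ x₂ x₃ x₄ : Term 4
      x₁ = Ι zero
      x₂ = Ι (suc zero)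
      x₃ = Ι (suc (suc zero))
      x₄ = Ι (suc (suc (suc zero)))

      transfer : ∀ e → Solver.⟦_⟧ R e x R.≈ NR.# 2 → Solver.⟦_⟧ S e y S.≈ NS.# 2
      transfer e eq = S.trans (term-homo x y y≈fx e)
        (S.trans (⟦⟧-cong eq) (#-homo 2))

-- The span of B and C, and the conic

-- span s x y is x B + y C for the vectors B and C above.
module Span {c ℓ} (R : RawRing c ℓ) where
  open Notation R

  T : Carrier → Carrier
  T s = s ^ 2 + # 5 * s + # 5

  form : (s x y : Carrier) → Carrier
  form s x y = x ^ 2 - # 2 * T s * x * y + y ^ 2

  next : (s x y : Carrier) → Carrier
  next s x y = # 2 * T s * y - x

  span₁ span₂ span₃ span₄ : (s x y : Carrier) → Carrier
  span₁ s x y = (s + # 1) * x - (s + # 4) * y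
  span₂ s x y = (s + # 2) * x + (s + # 3) * y
  span₃ s x y = (s + # 3) * x + (s + # 2) * y
  span₄ s x y = (s + # 4) * x - (s + # 1) * y

  span : (s x y : Carrier) → Vec Carrier 4
  span s x y = span₁ s x y ∷ span₂ s x y ∷ span₃ s x y ∷ span₄ s x y ∷ []

  -- Let pᵢ = P₄ + P₂ + P₀ be the homogeneous parts of pᵢ at x B + y C, and h = form s x y.
  -- Then P₄ + P₂ h + P₀ h² is q times the i-th coordinate of (2T y − x) B + y C, and
  -- this is pᵢ + (h − 1) cofactorᵢ for cofactorᵢ = P₂ + P₀ + P₀ h.
  cofactor₁ cofactor₂ cofactor₃ cofactor₄ : (s x y : Carrier) → Carrier
  cofactor₁ s x y = # 2 * x ^ 2 - # 4 * x * y - # 8 * (s + # 2) * (s + # 3) * y ^ 2 - # 2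
  cofactor₂ s x y = (# 4 * s + # 10) * x * y - (# 8 * s ^ 2 + # 44 * s + # 60) * y ^ 2 - # 2
  cofactor₃ s x y = (# 8 * s + # 20) * x * y - (# 8 * s ^ 2 + # 48 * s + # 70) * y ^ 2 - # 2
  cofactor₄ s x y = (# 12 * s + # 30) * x * y - (# 8 * s ^ 2 + # 52 * s + # 80) * y ^ 2 - # 2

module Terms where
  open Span (termRing 1)

  s : Term 1
  s = Ι zero

  -- For n ≥ 1 this is the Chebyshev polynomial of the second kind of index n - 1, taken at T.
  u : ℕ → Term 1
  u zero          = Κ (+ 0)
  u (suc zero)    = Κ (+ 1)
  u (suc (suc n)) = next s (u n) (u (suc n))

  x₁ x₂ x₃ x₄ : ℕ → Term 1
  x₁ n = span₁ s (u (suc n)) (u n)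
  x₂ n = span₂ s (u (suc n)) (u n)
  x₃ n = span₃ s (u (suc n)) (u n)
  x₄ n = span₄ s (u (suc n)) (u n)

  x : ℕ → Vec (Term 1) 4
  x n = x₁ n ∷ x₂ n ∷ x₃ n ∷ x₄ n ∷ []

-- Identities between points of the span, modulo the conic

module SpanProperties {c ℓ} (R : CommutativeRing c ℓ) where
  open CommutativeRing R using (rawRing; sym; trans; +-congˡ; *-congˡ; +-group)
  open Notation rawRing
  open Span rawRing
  open Solver R
  private
    module N₁ = Notation (termRing 1)
    module N = Notation (termRing 3)
    module E₁ = Span (termRing 1)
    module E = Span (termRing 3)

  -- A certificate that a - b lies in the ideal generated by u - v: the cofactor `w` turns an
  -- equation that depends on `u ≈ v` into a polynomial identity, which the solver can check.
  modulo : ∀ {u v} w {a b} → u ≈ v → a + w * u ≈ b + w * v → a ≈ b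
  modulo w u≈v eq = GroupProperties.∙-cancelʳ +-group _ _ _
    (trans eq (+-congˡ (*-congˡ (sym u≈v))))

  module _ (s x y : Carrier) (form≈1 : form s x y ≈ # 1) where

    φ₁-span : p₁ rawRing (span s x y) ≈ q rawRing (span s x y) * span₁ s (next s x y) y
    φ₁-span = modulo (cofactor₁ s x y) form≈1 (solve 3 (λ s x y →
      p₁ (termRing 3) (E.span s x y) N.+ E.cofactor₁ s x y N.* E.form s x y ,
      q (termRing 3) (E.span s x y) N.* E.span₁ s (E.next s x y) y N.+ E.cofactor₁ s x y N.* N.# 1) ≡.refl s x y)

    φ₂-span : p₂ rawRing (span s x y) ≈ q rawRing (span s x y) * span₂ s (next s x y) y
    φ₂-span = modulo (cofactor₂ s x y) form≈1 (solve 3 (λ s x y →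
      p₂ (termRing 3) (E.span s x y) N.+ E.cofactor₂ s x y N.* E.form s x y ,
      q (termRing 3) (E.span s x y) N.* E.span₂ s (E.next s x y) y N.+ E.cofactor₂ s x y N.* N.# 1) ≡.refl s x y)

    φ₃-span : p₃ rawRing (span s x y) ≈ q rawRing (span s x y) * span₃ s (next s x y) y
    φ₃-span = modulo (cofactor₃ s x y) form≈1 (solve 3 (λ s x y →
      p₃ (termRing 3) (E.span s x y) N.+ E.cofactor₃ s x y N.* E.form s x y ,
      q (termRing 3) (E.span s x y) N.* E.span₃ s (E.next s x y) y N.+ E.cofactor₃ s x y N.* N.# 1) ≡.refl s x y)

    φ₄-span : p₄ rawRing (span s x y) ≈ q rawRing (span s x y) * span₄ s (next s x y) y
    φ₄-span = modulo (cofactor₄ s x y) form≈1 (solve 3 (λ s x y →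
      p₄ (termRing 3) (E.span s x y) N.+ E.cofactor₄ s x y N.* E.form s x y ,
      q (termRing 3) (E.span s x y) N.* E.span₄ s (E.next s x y) y N.+ E.cofactor₄ s x y N.* N.# 1) ≡.refl s x y)

  -- B is an arithmetic progression with difference 1, so its second difference vanishes and only y
  -- C contributes to a - 2b + c; likewise b - c is y - x.
  q-span : ∀ s x y → q rawRing (span s x y) ≈ - (# 2 * s + # 8) * ((y - x) * (y - x) * y)
  q-span = solve 3 (λ s x y → q (termRing 3) (E.span s x y) ,
    (N.- (N.# 2 N.* s N.+ N.# 8)) N.* ((y N.- x) N.* (y N.- x) N.* y)) ≡.refl

  swap₁ : ∀ s x y → - span₄ s y x ≈ span₁ s x y
  swap₁ = solve 3 (λ s x y → N.- E.span₄ s y x , E.span₁ s x y) ≡.refl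

  swap₂ : ∀ s x y → span₃ s y x ≈ span₂ s x y
  swap₂ = solve 3 (λ s x y → E.span₃ s y x , E.span₂ s x y) ≡.refl

  swap₃ : ∀ s x y → span₂ s y x ≈ span₃ s x y
  swap₃ = solve 3 (λ s x y → E.span₂ s y x , E.span₃ s x y) ≡.refl

  swap₄ : ∀ s x y → - span₁ s y x ≈ span₄ s x y
  swap₄ = solve 3 (λ s x y → N.- E.span₁ s y x , E.span₄ s x y) ≡.refl

  -- `span₁` is linear in its last two arguments, so it inherits their recurrence. With `x = u n`
  -- and `y = u (suc n)` the three points have indices n + 2, n + 1 and n.
  span₁-recurrence : ∀ s x y →
    span₁ s (next s y (next s x y)) (next s x y) ≈ # 2 * T s * span₁ s (next s x y) y - span₁ s y x
  span₁-recurrence = solve 3 (λ s x y → E.span₁ s (E.next s y (E.next s x y)) (E.next s x y) ,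
    N.# 2 N.* E.T s N.* E.span₁ s (E.next s x y) y N.- E.span₁ s y x) ≡.refl

  span₂-recurrence : ∀ s x y →
    span₂ s (next s y (next s x y)) (next s x y) ≈ # 2 * T s * span₂ s (next s x y) y - span₂ s y x
  span₂-recurrence = solve 3 (λ s x y → E.span₂ s (E.next s y (E.next s x y)) (E.next s x y) ,
    N.# 2 N.* E.T s N.* E.span₂ s (E.next s x y) y N.- E.span₂ s y x) ≡.refl

  span₃-recurrence : ∀ s x y →
    span₃ s (next s y (next s x y)) (next s x y) ≈ # 2 * T s * span₃ s (next s x y) y - span₃ s y x
  span₃-recurrence = solve 3 (λ s x y → E.span₃ s (E.next s y (E.next s x y)) (E.next s x y) ,
    N.# 2 N.* E.T s N.* E.span₃ s (E.next s x y) y N.- E.span₃ s y x) ≡.refl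

  span₄-recurrence : ∀ s x y →
    span₄ s (next s y (next s x y)) (next s x y) ≈ # 2 * T s * span₄ s (next s x y) y - span₄ s y x
  span₄-recurrence = solve 3 (λ s x y → E.span₄ s (E.next s y (E.next s x y)) (E.next s x y) ,
    N.# 2 N.* E.T s N.* E.span₄ s (E.next s x y) y N.- E.span₄ s y x) ≡.refl

  form-swap : ∀ s x y → form s x y ≈ form s y x
  form-swap = solve 3 (λ s x y → E.form s x y , E.form s y x) ≡.refl

  -- For fixed `y` the value `next s x y` is the second root of the same monic quadratic in `x`
  -- (Vieta), and the form is symmetric.
  form-next : ∀ s x y → form s y (next s x y) ≈ form s x y
  form-next = solve 3 (λ s x y → E.form s y (E.next s x y) , E.form s x y) ≡.refl

  module _ {s x y : Carrier} (form≈1 : form s x y ≈ # 1) where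

    -- Before the conic is used, the left side equals 2 `form s x y`: the squares of B and those of
    -- C each have second difference 2, and the mixed terms contribute -4T x y.
    second-difference₁₂₃ : span₁ s x y ^ 2 - # 2 * span₂ s x y ^ 2 + span₃ s x y ^ 2 ≈ # 2
    second-difference₁₂₃ = modulo (# 2) (sym form≈1) (solve 3 (λ s x y →
      E.span₁ s x y N.^ 2 N.- N.# 2 N.* E.span₂ s x y N.^ 2 N.+ E.span₃ s x y N.^ 2 N.+ N.# 2 N.* N.# 1 ,
      N.# 2 N.+ N.# 2 N.* E.form s x y) ≡.refl s x y)

    second-difference₂₃₄ : span₂ s x y ^ 2 - # 2 * span₃ s x y ^ 2 + span₄ s x y ^ 2 ≈ # 2
    second-difference₂₃₄ = modulo (# 2) (sym form≈1) (solve 3 (λ s x y →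
      E.span₂ s x y N.^ 2 N.- N.# 2 N.* E.span₃ s x y N.^ 2 N.+ E.span₄ s x y N.^ 2 N.+ N.# 2 N.* N.# 1 ,
      N.# 2 N.+ N.# 2 N.* E.form s x y) ≡.refl s x y)

    private
      reverse : ∀ a b c → a ^ 2 - # 2 * b ^ 2 + c ^ 2 ≈ c ^ 2 - # 2 * b ^ 2 + a ^ 2
      reverse = solve 3 (λ a b c → a N.^ 2 N.- N.# 2 N.* b N.^ 2 N.+ c N.^ 2 ,
        c N.^ 2 N.- N.# 2 N.* b N.^ 2 N.+ a N.^ 2) ≡.refl

    span-isBüchi : Büchi.IsBüchi R (span s x y)
    span-isBüchi zero             (suc zero)       (suc (suc zero))       _ _ = second-difference₁₂₃
    span-isBüchi (suc zero)       (suc (suc zero)) (suc (suc (suc zero))) _ _ = second-difference₂₃₄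
    span-isBüchi zero             zero             _                      () _
    span-isBüchi zero             (suc (suc _))    _                      () _
    span-isBüchi (suc zero)       zero             _                      () _
    span-isBüchi (suc zero)       (suc zero)       _                      () _
    span-isBüchi (suc zero)       (suc (suc (suc _))) _                   () _
    span-isBüchi (suc (suc zero)) (suc (suc (suc zero))) (suc (suc (suc zero))) _ ()

    span∈X₄ : InX₄ rawRing (span s x y)
    span∈X₄ = trans (reverse _ _ _) second-difference₂₃₄ , trans (reverse _ _ _) second-difference₁₂₃

  module _ (s : Carrier) where
    private
      u : ℕ → Carrier
      u n = ⟦ Terms.u n ⟧ (s ∷ [])

    -- `form s x y` is the norm (y - T x)² - (T² - 1) x², so this says that βⁿ has norm 1. The proof
    -- uses only the invariance under `next`.
    form-u : ∀ n → form s (u n) (u (suc n)) ≈ # 1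
    form-u zero    = solve 1 (λ s → E₁.form s (N₁.# 0) (N₁.# 1) , N₁.# 1) ≡.refl s
    form-u (suc n) = trans (form-next s (u n) (u (suc n))) (form-u n)

    terms-areBüchi : ∀ n → ∃ λ x → x ≡ Vec.map (λ e → ⟦ e ⟧ (s ∷ [])) (Terms.x n) × Büchi.IsBüchi R x
    terms-areBüchi n = span s (u (suc n)) (u n) , ≡.refl ,
      -- `span` takes the later value of `u` before the earlier one, `form-u` the other way round.
      span-isBüchi (trans (form-swap s (u (suc n)) (u n)) (form-u n))

-- The commutative ring ℚ[t] and evaluation of polynomials

module PolynomialProperties where
  open ≡-Reasoning
  open CommutativeSemigroupProperties (CommutativeRing.+-commutativeSemigroup ℚ.+-*-commutativeRing)
    using (interchange; x∙yz≈y∙xz)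

  ≈ₚ-isEquivalence : IsEquivalence _≈ₚ_
  ≈ₚ-isEquivalence = record
    { refl  = mk≈ₚ λ _ → ≡.refl
    ; sym   = λ p≈q → mk≈ₚ λ k → ≡.sym (coeff≡ p≈q k)
    ; trans = λ p≈q q≈r → mk≈ₚ λ k → ≡.trans (coeff≡ p≈q k) (coeff≡ q≈r k)
    }

  -- Prepending `0ℚ` is multiplication by t. The shift lemmas speak of single coefficients because
  -- `coeff (0ℚ ∷ p) k` reduces only once `k` is split.
  shift-cong : ∀ {p q} → p ≈ₚ q → ∀ k → coeff (0ℚ ∷ p) k ≡ coeff (0ℚ ∷ q) k
  shift-cong p≈q zero    = ≡.refl
  shift-cong p≈q (suc k) = coeff≡ p≈q k

  shift-+ : ∀ p q k → coeff (0ℚ ∷ p +ₚ q) k ≡ coeff (0ℚ ∷ p) k ℚ.+ coeff (0ℚ ∷ q) k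
  shift-+ p q zero    = ≡.refl
  shift-+ p q (suc k) = coeff-+ p q k

  shift-scale : ∀ a p k → coeff (0ℚ ∷ map (a ℚ.*_) p) k ≡ a ℚ.* coeff (0ℚ ∷ p) k
  shift-scale a p zero    = ≡.sym (ℚ.*-zeroʳ a)
  shift-scale a p (suc k) = coeff-scale a p k

  +ₚ-cong : ∀ {p p′ q q′} → p ≈ₚ p′ → q ≈ₚ q′ → p +ₚ q ≈ₚ p′ +ₚ q′
  +ₚ-cong {p} {p′} {q} {q′} p≈p′ q≈q′ = mk≈ₚ λ k → begin
    coeff (p +ₚ q) k           ≡⟨ coeff-+ p q k ⟩
    coeff p k ℚ.+ coeff q k    ≡⟨ cong₂ ℚ._+_ (coeff≡ p≈p′ k) (coeff≡ q≈q′ k) ⟩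
    coeff p′ k ℚ.+ coeff q′ k  ≡⟨ coeff-+ p′ q′ k ⟨
    coeff (p′ +ₚ q′) k         ∎

  +ₚ-assoc : ∀ p q r → (p +ₚ q) +ₚ r ≈ₚ p +ₚ (q +ₚ r)
  +ₚ-assoc p q r = mk≈ₚ λ k → begin
    coeff (p +ₚ q +ₚ r) k                    ≡⟨ coeff-+ (p +ₚ q) r k ⟩
    coeff (p +ₚ q) k ℚ.+ coeff r k           ≡⟨ cong (ℚ._+ coeff r k) (coeff-+ p q k) ⟩
    coeff p k ℚ.+ coeff q k ℚ.+ coeff r k    ≡⟨ ℚ.+-assoc (coeff p k) (coeff q k) (coeff r k) ⟩
    coeff p k ℚ.+ (coeff q k ℚ.+ coeff r k)  ≡⟨ cong (coeff p k ℚ.+_) (coeff-+ q r k) ⟨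
    coeff p k ℚ.+ coeff (q +ₚ r) k           ≡⟨ coeff-+ p (q +ₚ r) k ⟨
    coeff (p +ₚ (q +ₚ r)) k                  ∎

  +ₚ-comm : ∀ p q → p +ₚ q ≈ₚ q +ₚ p
  +ₚ-comm p q = mk≈ₚ λ k → begin
    coeff (p +ₚ q) k         ≡⟨ coeff-+ p q k ⟩
    coeff p k ℚ.+ coeff q k  ≡⟨ ℚ.+-comm (coeff p k) (coeff q k) ⟩
    coeff q k ℚ.+ coeff p k  ≡⟨ coeff-+ q p k ⟨
    coeff (q +ₚ p) k         ∎

  coeff-neg : ∀ p k → coeff (map (λ a → ℚ.- a) p) k ≡ ℚ.- coeff p k
  coeff-neg []      k       = ≡.refl
  coeff-neg (a ∷ p) zero    = ≡.refl
  coeff-neg (a ∷ p) (suc k) = coeff-neg p k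

  -ₚ-cong : ∀ {p q} → p ≈ₚ q → map (λ a → ℚ.- a) p ≈ₚ map (λ a → ℚ.- a) q
  -ₚ-cong {p} {q} p≈q = mk≈ₚ λ k →
    ≡.trans (coeff-neg p k) (≡.trans (cong (ℚ.-_) (coeff≡ p≈q k)) (≡.sym (coeff-neg q k)))

  -ₚ-inverseˡ : ∀ p → map (λ a → ℚ.- a) p +ₚ p ≈ₚ []
  -ₚ-inverseˡ p = mk≈ₚ λ k → ≡.trans (coeff-+ (map (λ a → ℚ.- a) p) p k)
    (≡.trans (cong (ℚ._+ coeff p k) (coeff-neg p k)) (ℚ.+-inverseˡ (coeff p k)))

  -- Mirror image of `coeff-∷*`: the product recurses on its left factor, and here the right factor
  -- is peeled. Commutativity comes from comparing the two.
  coeff-*∷ : ∀ p b q k → coeff (p *ₚ (b ∷ q)) k ≡ b ℚ.* coeff p k ℚ.+ coeff (0ℚ ∷ p *ₚ q) k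
  coeff-*∷ []      b q zero    = ≡.sym (≡.trans (ℚ.+-identityʳ (b ℚ.* 0ℚ)) (ℚ.*-zeroʳ b))
  coeff-*∷ []      b q (suc k) = ≡.sym (≡.trans (ℚ.+-identityʳ (b ℚ.* 0ℚ)) (ℚ.*-zeroʳ b))
  coeff-*∷ (a ∷ p) b q zero    = cong (ℚ._+ 0ℚ) (ℚ.*-comm a b)
  coeff-*∷ (a ∷ p) b q (suc k) = begin
    coeff ((a ∷ p) *ₚ (b ∷ q)) (suc k)                               ≡⟨ coeff-∷* a p (b ∷ q) (suc k) ⟩
    a ℚ.* coeff q k ℚ.+ coeff (p *ₚ (b ∷ q)) k                       ≡⟨ cong (a ℚ.* coeff q k ℚ.+_) (coeff-*∷ p b q k) ⟩
    a ℚ.* coeff q k ℚ.+ (b ℚ.* coeff p k ℚ.+ coeff (0ℚ ∷ p *ₚ q) k)  ≡⟨ x∙yz≈y∙xz (a ℚ.* coeff q k) (b ℚ.* coeff p k) _ ⟩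
    b ℚ.* coeff p k ℚ.+ (a ℚ.* coeff q k ℚ.+ coeff (0ℚ ∷ p *ₚ q) k)  ≡⟨ cong (b ℚ.* coeff p k ℚ.+_) (coeff-∷* a p q k) ⟨
    b ℚ.* coeff p k ℚ.+ coeff ((a ∷ p) *ₚ q) k                       ∎

  *ₚ-zeroʳ : ∀ p → p *ₚ [] ≈ₚ []
  *ₚ-zeroʳ []      = mk≈ₚ λ _ → ≡.refl
  *ₚ-zeroʳ (a ∷ p) = mk≈ₚ λ { zero → ≡.refl ; (suc k) → coeff≡ (*ₚ-zeroʳ p) k }

  *ₚ-comm : ∀ p q → p *ₚ q ≈ₚ q *ₚ p
  *ₚ-comm []      q = IsEquivalence.sym ≈ₚ-isEquivalence (*ₚ-zeroʳ q)
  *ₚ-comm (a ∷ p) q = mk≈ₚ λ k → begin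
    coeff ((a ∷ p) *ₚ q) k                         ≡⟨ coeff-∷* a p q k ⟩
    a ℚ.* coeff q k ℚ.+ coeff (0ℚ ∷ p *ₚ q) k      ≡⟨ cong (a ℚ.* coeff q k ℚ.+_) (shift-cong (*ₚ-comm p q) k) ⟩
    a ℚ.* coeff q k ℚ.+ coeff (0ℚ ∷ q *ₚ p) k      ≡⟨ coeff-*∷ q a p k ⟨
    coeff (q *ₚ (a ∷ p)) k                         ∎

  *ₚ-congˡ : ∀ p {q q′} → q ≈ₚ q′ → p *ₚ q ≈ₚ p *ₚ q′
  *ₚ-congˡ []      q≈q′ = mk≈ₚ λ _ → ≡.refl
  *ₚ-congˡ (a ∷ p) {q} {q′} q≈q′ = mk≈ₚ λ k → begin
    coeff ((a ∷ p) *ₚ q) k                       ≡⟨ coeff-∷* a p q k ⟩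
    a ℚ.* coeff q k ℚ.+ coeff (0ℚ ∷ p *ₚ q) k    ≡⟨ cong₂ (λ x y → a ℚ.* x ℚ.+ y) (coeff≡ q≈q′ k) (shift-cong (*ₚ-congˡ p q≈q′) k) ⟩
    a ℚ.* coeff q′ k ℚ.+ coeff (0ℚ ∷ p *ₚ q′) k  ≡⟨ coeff-∷* a p q′ k ⟨
    coeff ((a ∷ p) *ₚ q′) k                      ∎

  -- Equal polynomials may be lists of different lengths, which hampers induction on a left factor
  -- that varies; congruence there is borrowed from the right factor through commutativity.
  *ₚ-cong : ∀ {p p′ q q′} → p ≈ₚ p′ → q ≈ₚ q′ → p *ₚ q ≈ₚ p′ *ₚ q′
  *ₚ-cong {p} {p′} {q} {q′} p≈p′ q≈q′ = trans (*ₚ-congˡ p q≈q′)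
    (trans (*ₚ-comm p q′) (trans (*ₚ-congˡ q′ p≈p′) (*ₚ-comm q′ p′)))
    where open IsEquivalence ≈ₚ-isEquivalence

  *ₚ-distribʳ : ∀ r p q → (p +ₚ q) *ₚ r ≈ₚ p *ₚ r +ₚ q *ₚ r
  *ₚ-distribʳ r []      q       = IsEquivalence.refl ≈ₚ-isEquivalence
  *ₚ-distribʳ r (a ∷ p) []      = +ₚ-comm [] ((a ∷ p) *ₚ r)
  *ₚ-distribʳ r (a ∷ p) (b ∷ q) = mk≈ₚ λ k → begin
    coeff ((a ℚ.+ b ∷ p +ₚ q) *ₚ r) k
      ≡⟨ coeff-∷* (a ℚ.+ b) (p +ₚ q) r k ⟩
    (a ℚ.+ b) ℚ.* coeff r k ℚ.+ coeff (0ℚ ∷ (p +ₚ q) *ₚ r) k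
      ≡⟨ cong₂ ℚ._+_ (ℚ.*-distribʳ-+ (coeff r k) a b)
           (≡.trans (shift-cong (*ₚ-distribʳ r p q) k) (shift-+ (p *ₚ r) (q *ₚ r) k)) ⟩
    (a ℚ.* coeff r k ℚ.+ b ℚ.* coeff r k) ℚ.+ (coeff (0ℚ ∷ p *ₚ r) k ℚ.+ coeff (0ℚ ∷ q *ₚ r) k)
      ≡⟨ interchange (a ℚ.* coeff r k) (b ℚ.* coeff r k) (coeff (0ℚ ∷ p *ₚ r) k) (coeff (0ℚ ∷ q *ₚ r) k) ⟩
    (a ℚ.* coeff r k ℚ.+ coeff (0ℚ ∷ p *ₚ r) k) ℚ.+ (b ℚ.* coeff r k ℚ.+ coeff (0ℚ ∷ q *ₚ r) k)
      ≡⟨ cong₂ ℚ._+_ (coeff-∷* a p r k) (coeff-∷* b q r k) ⟨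
    coeff ((a ∷ p) *ₚ r) k ℚ.+ coeff ((b ∷ q) *ₚ r) k
      ≡⟨ coeff-+ ((a ∷ p) *ₚ r) ((b ∷ q) *ₚ r) k ⟨
    coeff ((a ∷ p) *ₚ r +ₚ (b ∷ q) *ₚ r) k ∎

  scale-* : ∀ a p q → map (a ℚ.*_) p *ₚ q ≈ₚ map (a ℚ.*_) (p *ₚ q)
  scale-* a []      q = IsEquivalence.refl ≈ₚ-isEquivalence
  scale-* a (b ∷ p) q = mk≈ₚ λ k → begin
    coeff ((a ℚ.* b ∷ map (a ℚ.*_) p) *ₚ q) k
      ≡⟨ coeff-∷* (a ℚ.* b) (map (a ℚ.*_) p) q k ⟩
    (a ℚ.* b) ℚ.* coeff q k ℚ.+ coeff (0ℚ ∷ map (a ℚ.*_) p *ₚ q) k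
      ≡⟨ cong₂ ℚ._+_ (ℚ.*-assoc a b (coeff q k))
           (≡.trans (shift-cong (scale-* a p q) k) (shift-scale a (p *ₚ q) k)) ⟩
    a ℚ.* (b ℚ.* coeff q k) ℚ.+ a ℚ.* coeff (0ℚ ∷ p *ₚ q) k
      ≡⟨ ℚ.*-distribˡ-+ a (b ℚ.* coeff q k) (coeff (0ℚ ∷ p *ₚ q) k) ⟨
    a ℚ.* (b ℚ.* coeff q k ℚ.+ coeff (0ℚ ∷ p *ₚ q) k)
      ≡⟨ cong (a ℚ.*_) (coeff-∷* b p q k) ⟨
    a ℚ.* coeff ((b ∷ p) *ₚ q) k
      ≡⟨ coeff-scale a ((b ∷ p) *ₚ q) k ⟨
    coeff (map (a ℚ.*_) ((b ∷ p) *ₚ q)) k ∎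

  0∷-* : ∀ p q → (0ℚ ∷ p) *ₚ q ≈ₚ 0ℚ ∷ p *ₚ q
  0∷-* p q = mk≈ₚ λ k → begin
    coeff ((0ℚ ∷ p) *ₚ q) k                      ≡⟨ coeff-∷* 0ℚ p q k ⟩
    0ℚ ℚ.* coeff q k ℚ.+ coeff (0ℚ ∷ p *ₚ q) k   ≡⟨ cong (ℚ._+ coeff (0ℚ ∷ p *ₚ q) k) (ℚ.*-zeroˡ (coeff q k)) ⟩
    0ℚ ℚ.+ coeff (0ℚ ∷ p *ₚ q) k                 ≡⟨ ℚ.+-identityˡ (coeff (0ℚ ∷ p *ₚ q) k) ⟩
    coeff (0ℚ ∷ p *ₚ q) k                        ∎

  *ₚ-assoc : ∀ p q r → (p *ₚ q) *ₚ r ≈ₚ p *ₚ (q *ₚ r)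
  *ₚ-assoc []      q r = IsEquivalence.refl ≈ₚ-isEquivalence
  *ₚ-assoc (a ∷ p) q r = trans (*ₚ-distribʳ r (map (a ℚ.*_) q) (0ℚ ∷ p *ₚ q))
    (+ₚ-cong (scale-* a q r) (trans (0∷-* (p *ₚ q) r) (mk≈ₚ (shift-cong (*ₚ-assoc p q r)))))
    where open IsEquivalence ≈ₚ-isEquivalence

  *ₚ-identityˡ : ∀ p → (1ℚ ∷ []) *ₚ p ≈ₚ p
  *ₚ-identityˡ p = mk≈ₚ λ k → begin
    coeff ((1ℚ ∷ []) *ₚ p) k                     ≡⟨ coeff-∷* 1ℚ [] p k ⟩
    1ℚ ℚ.* coeff p k ℚ.+ coeff (0ℚ ∷ []) k       ≡⟨ cong₂ ℚ._+_ (ℚ.*-identityˡ (coeff p k)) (zeros k) ⟩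
    coeff p k ℚ.+ 0ℚ                             ≡⟨ ℚ.+-identityʳ (coeff p k) ⟩
    coeff p k                                    ∎
    where
    zeros : ∀ k → coeff (0ℚ ∷ []) k ≡ 0ℚ
    zeros zero    = ≡.refl
    zeros (suc k) = ≡.refl

  polynomialCommutativeRing : CommutativeRing _ _
  polynomialCommutativeRing = buildCommutativeRing polynomialRing ≈ₚ-isEquivalence
    +ₚ-cong +ₚ-assoc +ₚ-comm (λ _ → IsEquivalence.refl ≈ₚ-isEquivalence)
    -ₚ-cong -ₚ-inverseˡ
    *ₚ-cong *ₚ-assoc *ₚ-comm *ₚ-identityˡ *ₚ-distribʳ

  module _ (x : ℚ) where
    open RingMorphisms polynomialRing (CommutativeRing.rawRing ℚ.+-*-commutativeRing) using (IsRingHomomorphism)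

    eval-+ : ∀ p q → eval (p +ₚ q) x ≡ eval p x ℚ.+ eval q x
    eval-+ []      q       = ≡.sym (ℚ.+-identityˡ (eval q x))
    eval-+ (a ∷ p) []      = ≡.sym (ℚ.+-identityʳ (eval (a ∷ p) x))
    eval-+ (a ∷ p) (b ∷ q) = begin
      (a ℚ.+ b) ℚ.+ x ℚ.* eval (p +ₚ q) x            ≡⟨ cong (λ y → (a ℚ.+ b) ℚ.+ x ℚ.* y) (eval-+ p q) ⟩
      (a ℚ.+ b) ℚ.+ x ℚ.* (eval p x ℚ.+ eval q x)    ≡⟨ cong ((a ℚ.+ b) ℚ.+_) (ℚ.*-distribˡ-+ x (eval p x) (eval q x)) ⟩
      (a ℚ.+ b) ℚ.+ (x ℚ.* eval p x ℚ.+ x ℚ.* eval q x) ≡⟨ interchange a b (x ℚ.* eval p x) (x ℚ.* eval q x) ⟩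
      eval (a ∷ p) x ℚ.+ eval (b ∷ q) x              ∎

    eval-scale : ∀ a p → eval (map (a ℚ.*_) p) x ≡ a ℚ.* eval p x
    eval-scale a []      = ≡.sym (ℚ.*-zeroʳ a)
    eval-scale a (b ∷ p) = begin
      a ℚ.* b ℚ.+ x ℚ.* eval (map (a ℚ.*_) p) x  ≡⟨ cong (λ y → a ℚ.* b ℚ.+ x ℚ.* y) (eval-scale a p) ⟩
      a ℚ.* b ℚ.+ x ℚ.* (a ℚ.* eval p x)         ≡⟨ cong (a ℚ.* b ℚ.+_) (x∙yz≈y∙xz* x a (eval p x)) ⟩
      a ℚ.* b ℚ.+ a ℚ.* (x ℚ.* eval p x)         ≡⟨ ℚ.*-distribˡ-+ a b (x ℚ.* eval p x) ⟨
      a ℚ.* eval (b ∷ p) x                       ∎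
      where open CommutativeSemigroupProperties (CommutativeRing.*-commutativeSemigroup ℚ.+-*-commutativeRing)
              using () renaming (x∙yz≈y∙xz to x∙yz≈y∙xz*)

    eval-* : ∀ p q → eval (p *ₚ q) x ≡ eval p x ℚ.* eval q x
    eval-* []      q = ≡.sym (ℚ.*-zeroˡ (eval q x))
    eval-* (a ∷ p) q = begin
      eval (map (a ℚ.*_) q +ₚ (0ℚ ∷ p *ₚ q)) x                 ≡⟨ eval-+ (map (a ℚ.*_) q) (0ℚ ∷ p *ₚ q) ⟩
      eval (map (a ℚ.*_) q) x ℚ.+ (0ℚ ℚ.+ x ℚ.* eval (p *ₚ q) x)
        ≡⟨ cong₂ ℚ._+_ (eval-scale a q) (≡.trans (ℚ.+-identityˡ _) (cong (x ℚ.*_) (eval-* p q))) ⟩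
      a ℚ.* eval q x ℚ.+ x ℚ.* (eval p x ℚ.* eval q x)         ≡⟨ cong (a ℚ.* eval q x ℚ.+_) (ℚ.*-assoc x (eval p x) (eval q x)) ⟨
      a ℚ.* eval q x ℚ.+ (x ℚ.* eval p x) ℚ.* eval q x         ≡⟨ ℚ.*-distribʳ-+ (eval q x) a (x ℚ.* eval p x) ⟨
      eval (a ∷ p) x ℚ.* eval q x                              ∎

    eval-neg : ∀ p → eval (map (λ a → ℚ.- a) p) x ≡ ℚ.- eval p x
    eval-neg []      = ≡.refl
    eval-neg (a ∷ p) = begin
      ℚ.- a ℚ.+ x ℚ.* eval (map (λ a → ℚ.- a) p) x  ≡⟨ cong (λ y → ℚ.- a ℚ.+ x ℚ.* y) (eval-neg p) ⟩
      ℚ.- a ℚ.+ x ℚ.* (ℚ.- eval p x)                ≡⟨ cong (ℚ.- a ℚ.+_) (ℚ.neg-distribʳ-* x (eval p x)) ⟨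
      ℚ.- a ℚ.+ ℚ.- (x ℚ.* eval p x)                ≡⟨ ℚ.neg-distrib-+ a (x ℚ.* eval p x) ⟨
      ℚ.- eval (a ∷ p) x                            ∎

    -- Handles the surplus trailing zeros when equal polynomials are lists of different lengths.
    eval-≈0 : ∀ p → p ≈ₚ [] → eval p x ≡ 0ℚ
    eval-≈0 []      p≈0 = ≡.refl
    eval-≈0 (a ∷ p) p≈0 = begin
      a ℚ.+ x ℚ.* eval p x  ≡⟨ cong₂ (λ b y → b ℚ.+ x ℚ.* y) (coeff≡ p≈0 0) (eval-≈0 p (mk≈ₚ λ k → coeff≡ p≈0 (suc k))) ⟩
      0ℚ ℚ.+ x ℚ.* 0ℚ       ≡⟨ ℚ.+-identityˡ (x ℚ.* 0ℚ) ⟩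
      x ℚ.* 0ℚ              ≡⟨ ℚ.*-zeroʳ x ⟩
      0ℚ                    ∎

    eval-cong : ∀ {p q} → p ≈ₚ q → eval p x ≡ eval q x
    eval-cong {[]}    {q}     p≈q = ≡.sym (eval-≈0 q (IsEquivalence.sym ≈ₚ-isEquivalence p≈q))
    eval-cong {a ∷ p} {[]}    p≈q = eval-≈0 (a ∷ p) p≈q
    eval-cong {a ∷ p} {b ∷ q} p≈q = cong₂ (λ c y → c ℚ.+ x ℚ.* y) (coeff≡ p≈q 0)
      (eval-cong {p} {q} (mk≈ₚ λ k → coeff≡ p≈q (suc k)))

    eval-isRingHomomorphism : IsRingHomomorphism (λ p → eval p x)
    eval-isRingHomomorphism = buildHomomorphism polynomialRing (CommutativeRing.rawRing ℚ.+-*-commutativeRing)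
      (λ p → eval p x) eval-cong eval-+ eval-* eval-neg ≡.refl
      (≡.trans (cong (1ℚ ℚ.+_) (ℚ.*-zeroʳ x)) (ℚ.+-identityʳ 1ℚ))

-- Rationals are stored in lowest terms, so sums and products of `i / 1` and `j / 1` do not compute
-- for variable integers. The laws are checked on unnormalised fractions with denominator 1 and
-- pulled back along the injective `toℚᵘ`.
/1-isRingHomomorphism : RingMorphisms.IsRingHomomorphism
  (CommutativeRing.rawRing ℤ.+-*-commutativeRing) (CommutativeRing.rawRing ℚ.+-*-commutativeRing) (ℚ._/ 1)
/1-isRingHomomorphism = buildHomomorphism _ _ (ℚ._/ 1) (cong (ℚ._/ 1))
  (λ i j → lift₂ (ℚ._+_) (ℚᵘ._+_) ℚ.toℚᵘ-homo-+ ℚᵘ.+-cong ℤ._+_ ℤ₂ i j)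
  (λ i j → lift₂ (ℚ._*_) (ℚᵘ._*_) ℚ.toℚᵘ-homo-* ℚᵘ.*-cong ℤ._*_ (λ _ _ → ℚᵘ.*≡* ≡.refl) i j)
  (λ i → ℚ.toℚᵘ-injective (ℚᵘ.≃-trans (toℚᵘ-/1 (ℤ.- i))
    (ℚᵘ.≃-sym (ℚᵘ.≃-trans (ℚ.toℚᵘ-homo‿- (i ℚ./ 1)) (ℚᵘ.-‿cong (toℚᵘ-/1 i))))))
  ≡.refl ≡.refl
  where
  toℚᵘ-/1 : ∀ i → ℚ.toℚᵘ (i ℚ./ 1) ℚᵘ.≃ ℚᵘ.mkℚᵘ i 0
  toℚᵘ-/1 i = ℚ.toℚᵘ-fromℚᵘ (ℚᵘ.mkℚᵘ i 0)

  lift₂ : ∀ (_∙_ : ℚ → ℚ → ℚ) (_∙ᵘ_ : ℚᵘ.ℚᵘ → ℚᵘ.ℚᵘ → ℚᵘ.ℚᵘ) →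
    (∀ x y → ℚ.toℚᵘ (x ∙ y) ℚᵘ.≃ (ℚ.toℚᵘ x ∙ᵘ ℚ.toℚᵘ y)) →
    (∀ {x y z w} → x ℚᵘ.≃ y → z ℚᵘ.≃ w → (x ∙ᵘ z) ℚᵘ.≃ (y ∙ᵘ w)) →
    (_∙ᶻ_ : ℤ.ℤ → ℤ.ℤ → ℤ.ℤ) →
    (∀ i j → ℚᵘ.mkℚᵘ (i ∙ᶻ j) 0 ℚᵘ.≃ (ℚᵘ.mkℚᵘ i 0 ∙ᵘ ℚᵘ.mkℚᵘ j 0)) →
    ∀ i j → (i ∙ᶻ j) ℚ./ 1 ≡ (i ℚ./ 1) ∙ (j ℚ./ 1)
  lift₂ _∙_ _∙ᵘ_ homo ∙-cong _∙ᶻ_ /1-∙ i j = ℚ.toℚᵘ-injective (ℚᵘ.≃-trans (toℚᵘ-/1 (i ∙ᶻ j)) (ℚᵘ.≃-trans (/1-∙ i j)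
    (ℚᵘ.≃-sym (ℚᵘ.≃-trans (homo (i ℚ./ 1) (j ℚ./ 1)) (∙-cong (toℚᵘ-/1 i) (toℚᵘ-/1 j))))))

  ℤ₂ : ∀ i j → ℚᵘ.mkℚᵘ (i ℤ.+ j) 0 ℚᵘ.≃ (ℚᵘ.mkℚᵘ i 0 ℚᵘ.+ ℚᵘ.mkℚᵘ j 0)
  ℤ₂ i j = ℚᵘ.*≡* (cong (ℤ._* ℤ.+ 1) (≡.sym (cong₂ ℤ._+_ (ℤ.*-identityʳ i) (ℤ.*-identityʳ j))))

open PolynomialProperties

-- The ring structure of ℚ(t) and division in it

module FunctionFieldProperties where
  open CommutativeRing polynomialCommutativeRing
    using (setoid; +-cong; *-cong; *-congˡ; *-congʳ; -‿cong; ring; +-group) renaming (refl to ≈-refl; sym to ≈-sym; trans to ≈-trans)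
  open Notation polynomialRing
  open Solver polynomialCommutativeRing using (solve)
  open SetoidReasoning setoid
  open RingProperties ring using (x[y-z]≈xy-xz; -‿distribˡ-*)
  open GroupProperties +-group using () renaming (x∙y⁻¹≈ε⇒x≈y to x-y≈0⇒x≈y; x≈y⇒x∙y⁻¹≈ε to x≈y⇒x-y≈0)
  private
    module F = Notation functionField
    module N₃ = Notation (termRing 3)
    module N₄ = Notation (termRing 4)
    module N₆ = Notation (termRing 6)

  *-cancelˡ : ∀ {c x y} → ¬ (c ≈ 0#) → c * x ≈ c * y → x ≈ y
  *-cancelˡ {c} {x} {y} c≉0 cx≈cy = [ (λ c≈0 → contradiction c≈0 c≉0) , x-y≈0⇒x≈y x y ]′
    (*ₚ-domain c (x - y) (≈-trans (x[y-z]≈xy-xz c x y) (x≈y⇒x-y≈0 cx≈cy)))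

  -- Cross-multiplication leaves the middle denominator as a common factor, which may be cancelled
  -- because ℚ[t] is a domain.
  ≈ₖ-trans : ∀ {x y z} → x ≈ₖ y → y ≈ₖ z → x ≈ₖ z
  ≈ₖ-trans {x} {y} {z} x≈y y≈z = mk≈ₖ (*-cancelˡ (den≉0 y) (begin
    den y * (num x * den z)  ≈⟨ rearrange (den y) (num x) (den z) ⟩
    num x * den y * den z    ≈⟨ *-congʳ (cross x≈y) ⟩
    num y * den x * den z    ≈⟨ rearrange′ (num y) (den x) (den z) ⟩
    num y * den z * den x    ≈⟨ *-congʳ (cross y≈z) ⟩
    num z * den y * den x    ≈⟨ rearrange (den y) (num z) (den x) ⟨
    den y * (num z * den x)  ∎))
    where
    rearrange : ∀ a b c → a * (b * c) ≈ b * a * c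
    rearrange = solve 3 (λ a b c → a N₃.* (b N₃.* c) , b N₃.* a N₃.* c) ≡.refl
    rearrange′ : ∀ a b c → a * b * c ≈ a * c * b
    rearrange′ = solve 3 (λ a b c → a N₃.* b N₃.* c , a N₃.* c N₃.* b) ≡.refl

  ≈ₖ-isEquivalence : IsEquivalence _≈ₖ_
  ≈ₖ-isEquivalence = record
    { refl  = mk≈ₖ ≈-refl
    ; sym   = λ x≈y → mk≈ₖ (≈-sym (cross x≈y))
    ; trans = ≈ₖ-trans
    }

  *ₖ-cong : ∀ {x x′ y y′} → x ≈ₖ x′ → y ≈ₖ y′ → (x F.* y) ≈ₖ (x′ F.* y′)
  *ₖ-cong {x} {x′} {y} {y′} x≈x′ y≈y′ = mk≈ₖ (begin
    num x * num y * (den x′ * den y′)      ≈⟨ interchange (num x) (num y) (den x′) (den y′) ⟩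
    (num x * den x′) * (num y * den y′)    ≈⟨ *-cong (cross x≈x′) (cross y≈y′) ⟩
    (num x′ * den x) * (num y′ * den y)    ≈⟨ interchange (num x′) (num y′) (den x) (den y) ⟨
    num x′ * num y′ * (den x * den y)      ∎)
    where
    interchange : ∀ a b c d → a * b * (c * d) ≈ (a * c) * (b * d)
    interchange = solve 4 (λ a b c d → a N₄.* b N₄.* (c N₄.* d) , (a N₄.* c) N₄.* (b N₄.* d)) ≡.refl

  +ₖ-cong : ∀ {x x′ y y′} → x ≈ₖ x′ → y ≈ₖ y′ → (x F.+ y) ≈ₖ (x′ F.+ y′)
  +ₖ-cong {x} {x′} {y} {y′} x≈x′ y≈y′ = mk≈ₖ (begin
    (num x * den y + num y * den x) * (den x′ * den y′)
      ≈⟨ rearrange (num x) (den x) (num y) (den y) (den x′) (den y′) ⟩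
    (num x * den x′) * (den y * den y′) + (num y * den y′) * (den x * den x′)
      ≈⟨ +-cong (*-congʳ (cross x≈x′)) (*-congʳ (cross y≈y′)) ⟩
    (num x′ * den x) * (den y * den y′) + (num y′ * den y) * (den x * den x′)
      ≈⟨ rearrange′ (num x′) (den x′) (num y′) (den y′) (den x) (den y) ⟩
    (num x′ * den y′ + num y′ * den x′) * (den x * den y)  ∎)
    where
    rearrange : ∀ a b c d e f → (a * d + c * b) * (e * f) ≈ (a * e) * (d * f) + (c * f) * (b * e)
    rearrange = solve 6 (λ a b c d e f → (a N₆.* d N₆.+ c N₆.* b) N₆.* (e N₆.* f) ,
      (a N₆.* e) N₆.* (d N₆.* f) N₆.+ (c N₆.* f) N₆.* (b N₆.* e)) ≡.refl
    rearrange′ : ∀ a b c d e f → (a * e) * (f * d) + (c * f) * (e * b) ≈ (a * d + c * b) * (e * f)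
    rearrange′ = solve 6 (λ a b c d e f →
      (a N₆.* e) N₆.* (f N₆.* d) N₆.+ (c N₆.* f) N₆.* (e N₆.* b) ,
      (a N₆.* d N₆.+ c N₆.* b) N₆.* (e N₆.* f)) ≡.refl

  functionFieldCommutativeRing : CommutativeRing _ _
  functionFieldCommutativeRing = buildCommutativeRing functionField ≈ₖ-isEquivalence
    +ₖ-cong
    (λ x y z → mk≈ₖ (solve 6 (λ a b c d e f →
      ((a N₆.* d N₆.+ c N₆.* b) N₆.* f N₆.+ e N₆.* (b N₆.* d)) N₆.* (b N₆.* (d N₆.* f)) ,
      (a N₆.* (d N₆.* f) N₆.+ (c N₆.* f N₆.+ e N₆.* d) N₆.* b) N₆.* (b N₆.* d N₆.* f))
      ≡.refl (num x) (den x) (num y) (den y) (num z) (den z)))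
    (λ x y → mk≈ₖ (solve 4 (λ a b c d →
      (a N₄.* d N₄.+ c N₄.* b) N₄.* (d N₄.* b) , (c N₄.* b N₄.+ a N₄.* d) N₄.* (b N₄.* d))
      ≡.refl (num x) (den x) (num y) (den y)))
    (λ x → mk≈ₖ (solve 2 (λ a b →
      (N₂.0# N₂.* b N₂.+ a N₂.* N₂.1#) N₂.* b , a N₂.* (N₂.1# N₂.* b)) ≡.refl (num x) (den x)))
    (λ {x} {y} x≈y → mk≈ₖ (begin
      (- num x) * den y  ≈⟨ -‿distribˡ-* (num x) (den y) ⟨
      - (num x * den y)  ≈⟨ -‿cong (cross x≈y) ⟩
      - (num y * den x)  ≈⟨ -‿distribˡ-* (num y) (den x) ⟩
      (- num y) * den x  ∎))
    (λ x → mk≈ₖ (solve 2 (λ a b →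
      ((N₂.- a) N₂.* b N₂.+ a N₂.* b) N₂.* N₂.1# , N₂.0# N₂.* (b N₂.* b)) ≡.refl (num x) (den x)))
    *ₖ-cong
    (λ x y z → mk≈ₖ (solve 6 (λ a b c d e f →
      a N₆.* c N₆.* e N₆.* (b N₆.* (d N₆.* f)) , a N₆.* (c N₆.* e) N₆.* (b N₆.* d N₆.* f))
      ≡.refl (num x) (den x) (num y) (den y) (num z) (den z)))
    (λ x y → mk≈ₖ (solve 4 (λ a b c d → a N₄.* c N₄.* (d N₄.* b) , c N₄.* a N₄.* (b N₄.* d))
      ≡.refl (num x) (den x) (num y) (den y)))
    (λ x → mk≈ₖ (solve 2 (λ a b → N₂.1# N₂.* a N₂.* b , a N₂.* (N₂.1# N₂.* b)) ≡.refl (num x) (den x)))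
    (λ z x y → mk≈ₖ (solve 6 (λ a b c d e f →
      (a N₆.* d N₆.+ c N₆.* b) N₆.* e N₆.* ((b N₆.* f) N₆.* (d N₆.* f)) ,
      ((a N₆.* e) N₆.* (d N₆.* f) N₆.+ (c N₆.* e) N₆.* (b N₆.* f)) N₆.* (b N₆.* d N₆.* f))
      ≡.refl (num x) (den x) (num y) (den y) (num z) (den z)))
    where
    module N₂ = Notation (termRing 2)

  open RingMorphisms polynomialRing functionField using (IsRingHomomorphism)

  fromPoly-isRingHomomorphism : IsRingHomomorphism fromPoly
  fromPoly-isRingHomomorphism = buildHomomorphism polynomialRing functionField fromPoly
    (λ p≈q → mk≈ₖ (*-congʳ p≈q))
    (λ p q → mk≈ₖ (solve 2 (λ a b →
      (a N₂.+ b) N₂.* (N₂.1# N₂.* N₂.1#) , (a N₂.* N₂.1# N₂.+ b N₂.* N₂.1#) N₂.* N₂.1#) ≡.refl p q))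
    (λ p q → mk≈ₖ (solve 2 (λ a b → a N₂.* b N₂.* (N₂.1# N₂.* N₂.1#) , a N₂.* b N₂.* N₂.1#) ≡.refl p q))
    (λ p → mk≈ₖ ≈-refl) (mk≈ₖ ≈-refl) (mk≈ₖ ≈-refl)
    where module N₂ = Notation (termRing 2)

  fromPoly-injective : ∀ {p q} → fromPoly p ≈ₖ fromPoly q → p ≈ q
  fromPoly-injective {p} {q} eq = begin
    p       ≈⟨ *-identityʳ p ⟨
    p * 1#  ≈⟨ cross eq ⟩
    q * 1#  ≈⟨ *-identityʳ q ⟩
    q       ∎
    where open CommutativeRing polynomialCommutativeRing using (*-identityʳ)

  *-recipₖ : ∀ x (x≉0 : x F.≉ F.0#) → (x F.* recipₖ x x≉0) ≈ₖ F.1#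
  *-recipₖ x x≉0 = mk≈ₖ (solve 2 (λ a b → a N₂.* b N₂.* N₂.1# , N₂.1# N₂.* (b N₂.* a)) ≡.refl (num x) (den x))
    where module N₂ = Notation (termRing 2)

  -- Converts the division-free identities for φ into statements about its quotients.
  divₖ-unique : ∀ {x y z} (y≉0 : y F.≉ F.0#) → x ≈ₖ (y F.* z) → divₖ x y y≉0 ≈ₖ z
  divₖ-unique {x} {y} {z} y≉0 x≈yz = K.trans (K.*-congʳ {recipₖ y y≉0} (K.trans x≈yz (K.*-comm y z)))
    (K.trans (K.*-assoc z y (recipₖ y y≉0)) (K.trans (K.*-congˡ {z} (*-recipₖ y y≉0)) (K.*-identityʳ z)))
    where module K = CommutativeRing functionFieldCommutativeRing

open FunctionFieldProperties

-- Degrees in ℚ[t] and the nonvanishing of `q`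

module Degrees where
  open Notation polynomialRing
  open CommutativeRing polynomialCommutativeRing using (refl; sym; trans)
  open Span polynomialRing
  open SpanProperties polynomialCommutativeRing
  private
    module ⟦ℚ[t]⟧ = Solver polynomialCommutativeRing
    module N₃ = Notation (termRing 3)
    module E₃ = Span (termRing 3)

  tₚ : ℚ[t]
  tₚ = 0ℚ ∷ 1ℚ ∷ []

  -- With the index in the form `suc d + k`, the coefficient of an explicit list reduces past the
  -- end of the list, so `≡.refl` proves the bound in concrete cases.
  degree : ∀ p d → coeff p d ≢ 0ℚ → (∀ k → coeff p (suc d ℕ.+ k) ≡ 0ℚ) → HasDegree p d
  degree p d leading≢0 above≡0 = leading≢0 , λ k d<k →
    ≡.trans (cong (coeff p) (≡.sym (ℕ.m+[n∸m]≡n d<k))) (above≡0 (k ℕ.∸ suc d))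

  degree⇒≉0 : ∀ p {d} → HasDegree p d → ¬ (p ≈ 0#)
  degree⇒≉0 p {d} (leading≢0 , _) p≈0 = leading≢0 (coeff≡ p≈0 d)

  private
    2ℚ 10ℚ : ℚ
    2ℚ  = coeff (# 2) 0
    10ℚ = coeff (# 10) 0

  coeff-2T* : ∀ p k → coeff (# 2 * T tₚ * p) (2 ℕ.+ k) ≡
    10ℚ ℚ.* coeff p (2 ℕ.+ k) ℚ.+ (10ℚ ℚ.* coeff p (1 ℕ.+ k) ℚ.+ 2ℚ ℚ.* coeff p k)
  coeff-2T* p k = begin
    -- `# 2 * T tₚ` computes to this list, which is 2t² + 10t + 10.
    coeff ((10ℚ ∷ 10ℚ ∷ 2ℚ ∷ []) * p) (2 ℕ.+ k)
      ≡⟨ coeff-∷* 10ℚ (10ℚ ∷ 2ℚ ∷ []) p (2 ℕ.+ k) ⟩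
    10ℚ ℚ.* coeff p (2 ℕ.+ k) ℚ.+ coeff ((10ℚ ∷ 2ℚ ∷ []) * p) (1 ℕ.+ k)
      ≡⟨ cong (10ℚ ℚ.* coeff p (2 ℕ.+ k) ℚ.+_) (coeff-∷* 10ℚ (2ℚ ∷ []) p (1 ℕ.+ k)) ⟩
    10ℚ ℚ.* coeff p (2 ℕ.+ k) ℚ.+ (10ℚ ℚ.* coeff p (1 ℕ.+ k) ℚ.+ coeff ((2ℚ ∷ []) * p) k)
      ≡⟨ cong (λ c → 10ℚ ℚ.* coeff p (2 ℕ.+ k) ℚ.+ (10ℚ ℚ.* coeff p (1 ℕ.+ k) ℚ.+ c))
           (≡.trans (coeff-∷* 2ℚ [] p k) (≡.trans (cong (2ℚ ℚ.* coeff p k ℚ.+_) (zeros k)) (ℚ.+-identityʳ _))) ⟩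
    10ℚ ℚ.* coeff p (2 ℕ.+ k) ℚ.+ (10ℚ ℚ.* coeff p (1 ℕ.+ k) ℚ.+ 2ℚ ℚ.* coeff p k) ∎
    where
    open ≡-Reasoning
    zeros : ∀ k → coeff (0ℚ ∷ []) k ≡ 0ℚ
    zeros zero    = ≡.refl
    zeros (suc k) = ≡.refl

  -- From index d + 4 on, only the leading term 2t² of 2T meets coefficients of `y` that can be
  -- nonzero, and `x` has none left. So the leading coefficient doubles and cannot cancel.
  degree-step : ∀ x y z {d} → HasDegree x d → HasDegree y (2 ℕ.+ d) →
    z ≈ # 2 * T tₚ * y - x → HasDegree z (4 ℕ.+ d)
  degree-step x y z {d} (_ , x-bound) (y-leading , y-bound) z≈ =
    (λ z≡0 → y-leading (ℚ-cancel {2ℚ} (λ ()) (≡.trans (≡.sym (coeff-z (2 ℕ.+ d) ℕ.≤-refl)) z≡0))) ,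
    λ { (suc (suc k)) (s≤s (s≤s d+2<k)) → ≡.trans (coeff-z k (ℕ.<⇒≤ d+2<k))
          (≡.trans (cong (2ℚ ℚ.*_) (y-bound k d+2<k)) (ℚ.*-zeroʳ 2ℚ)) }
    where
    open ≡-Reasoning
    coeff-z : ∀ k → 2 ℕ.+ d ℕ.≤ k → coeff z (2 ℕ.+ k) ≡ 2ℚ ℚ.* coeff y k
    coeff-z k d+2≤k = begin
      coeff z (2 ℕ.+ k)
        ≡⟨ coeff≡ z≈ (2 ℕ.+ k) ⟩
      coeff (# 2 * T tₚ * y - x) (2 ℕ.+ k)
        ≡⟨ coeff-+ (# 2 * T tₚ * y) (- x) (2 ℕ.+ k) ⟩
      coeff (# 2 * T tₚ * y) (2 ℕ.+ k) ℚ.+ coeff (- x) (2 ℕ.+ k)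
        ≡⟨ cong₂ ℚ._+_ (coeff-2T* y k) (coeff-neg x (2 ℕ.+ k)) ⟩
      10ℚ ℚ.* coeff y (2 ℕ.+ k) ℚ.+ (10ℚ ℚ.* coeff y (1 ℕ.+ k) ℚ.+ 2ℚ ℚ.* coeff y k) ℚ.+ ℚ.- coeff x (2 ℕ.+ k)
        ≡⟨ cong₂ (λ a b → 10ℚ ℚ.* a ℚ.+ (10ℚ ℚ.* b ℚ.+ 2ℚ ℚ.* coeff y k) ℚ.+ ℚ.- coeff x (2 ℕ.+ k))
             (y-bound (2 ℕ.+ k) (ℕ.m≤n⇒m≤1+n (s≤s d+2≤k))) (y-bound (1 ℕ.+ k) (s≤s d+2≤k)) ⟩
      -- The products `10ℚ ℚ.* 0ℚ` are closed and compute to `0ℚ`.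
      0ℚ ℚ.+ (0ℚ ℚ.+ 2ℚ ℚ.* coeff y k) ℚ.+ ℚ.- coeff x (2 ℕ.+ k)
        ≡⟨ cong (λ a → 0ℚ ℚ.+ (0ℚ ℚ.+ 2ℚ ℚ.* coeff y k) ℚ.+ ℚ.- a)
             (x-bound (2 ℕ.+ k) (ℕ.≤-trans (ℕ.m≤n+m (suc d) 1) (ℕ.≤-trans d+2≤k (ℕ.m≤n+m k 2)))) ⟩
      0ℚ ℚ.+ (0ℚ ℚ.+ 2ℚ ℚ.* coeff y k) ℚ.+ 0ℚ
        ≡⟨ ≡.trans (ℚ.+-identityʳ _) (≡.trans (ℚ.+-identityˡ _) (ℚ.+-identityˡ _)) ⟩
      2ℚ ℚ.* coeff y k ∎

  -- The degree is written `n * 2 + d` so that two more steps reduce to `4 + (n * 2 + d)`, the shape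
  -- that `degree-step` delivers.
  degree-recurrence : (p : ℕ → ℚ[t]) → (∀ n → p (2 ℕ.+ n) ≈ # 2 * T tₚ * p (1 ℕ.+ n) - p n) → ∀ d →
    coeff (p 0) d ≢ 0ℚ → (∀ k → coeff (p 0) (1 ℕ.+ d ℕ.+ k) ≡ 0ℚ) →
    coeff (p 1) (2 ℕ.+ d) ≢ 0ℚ → (∀ k → coeff (p 1) (3 ℕ.+ d ℕ.+ k) ≡ 0ℚ) →
    ∀ n → HasDegree (p n) (n ℕ.* 2 ℕ.+ d)
  degree-recurrence p step d p₀≢0 p₀≡0 p₁≢0 p₁≡0 = go
    where
    go : ∀ n → HasDegree (p n) (n ℕ.* 2 ℕ.+ d)
    go zero          = degree (p 0) d p₀≢0 p₀≡0
    go (suc zero)    = degree (p 1) (2 ℕ.+ d) p₁≢0 p₁≡0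
    go (suc (suc n)) = degree-step (p n) (p (suc n)) (p (suc (suc n))) (go n) (go (suc n)) (step n)

  private
    u : ℕ → ℚ[t]
    u n = ⟦ℚ[t]⟧.⟦ Terms.u n ⟧ (tₚ ∷ [])

  -- Indexed from `u 1`, because `u 0` is zero and has no degree.
  u-degree : ∀ n → HasDegree (u (suc n)) (n ℕ.* 2 ℕ.+ 0)
  u-degree = degree-recurrence (λ n → u (suc n)) (λ _ → refl) 0
    (λ ()) (λ _ → ≡.refl) (λ ()) (λ _ → ≡.refl)

  -- Consecutive differences satisfy the same linear recurrence. They matter because (y - x)² is a
  -- factor of `q` on the span.
  u-difference-degree : ∀ n → HasDegree (u (suc n) - u n) (n ℕ.* 2 ℕ.+ 0)
  u-difference-degree = degree-recurrence (λ n → u (suc n) - u n)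
    (λ n → ⟦ℚ[t]⟧.solve 3 (λ s x y → E₃.next s y (E₃.next s x y) N₃.- E₃.next s x y ,
      N₃.# 2 N₃.* E₃.T s N₃.* (E₃.next s x y N₃.- y) N₃.- (y N₃.- x)) ≡.refl tₚ (u n) (u (suc n)))
    0 (λ ()) (λ _ → ≡.refl) (λ ()) (λ _ → ≡.refl)

  span₁-degree : ∀ n → HasDegree (span₁ tₚ (u (suc n)) (u n)) (n ℕ.* 2 ℕ.+ 1)
  span₁-degree = degree-recurrence (λ n → span₁ tₚ (u (suc n)) (u n))
    (λ n → span₁-recurrence tₚ (u n) (u (suc n))) 1
    (λ ()) (λ _ → ≡.refl) (λ ()) (λ _ → ≡.refl)

  span₂-degree : ∀ n → HasDegree (span₂ tₚ (u (suc n)) (u n)) (n ℕ.* 2 ℕ.+ 1)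
  span₂-degree = degree-recurrence (λ n → span₂ tₚ (u (suc n)) (u n))
    (λ n → span₂-recurrence tₚ (u n) (u (suc n))) 1
    (λ ()) (λ _ → ≡.refl) (λ ()) (λ _ → ≡.refl)

  span₃-degree : ∀ n → HasDegree (span₃ tₚ (u (suc n)) (u n)) (n ℕ.* 2 ℕ.+ 1)
  span₃-degree = degree-recurrence (λ n → span₃ tₚ (u (suc n)) (u n))
    (λ n → span₃-recurrence tₚ (u n) (u (suc n))) 1
    (λ ()) (λ _ → ≡.refl) (λ ()) (λ _ → ≡.refl)

  span₄-degree : ∀ n → HasDegree (span₄ tₚ (u (suc n)) (u n)) (n ℕ.* 2 ℕ.+ 1)
  span₄-degree = degree-recurrence (λ n → span₄ tₚ (u (suc n)) (u n))
    (λ n → span₄-recurrence tₚ (u n) (u (suc n))) 1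
    (λ ()) (λ _ → ≡.refl) (λ ()) (λ _ → ≡.refl)

  -- Each factor given by `q-span` has a degree and so is nonzero; in a domain the product is
  -- nonzero too.
  q≉0 : ∀ n → ¬ (q polynomialRing (span tₚ (u n) (u (suc n))) ≈ 0#)
  q≉0 n q≈0 = [ degree⇒≉0 c (degree c 1 (λ ()) λ _ → ≡.refl) , [ [ d≉0 , d≉0 ]′ ∘ *ₚ-domain d d ,
      degree⇒≉0 (u (suc n)) (u-degree n) ]′ ∘ *ₚ-domain (d * d) (u (suc n)) ]′
    (*ₚ-domain c (d * d * u (suc n)) (trans (sym (q-span tₚ (u n) (u (suc n)))) q≈0))
    where
    c d : ℚ[t]
    c = - (# 2 * tₚ + # 8)
    d = u (suc n) - u n
    d≉0 : ¬ (d ≈ 0#)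
    d≉0 = degree⇒≉0 d (u-difference-degree n)

open Degrees using (tₚ; q≉0)

-- Powers of T + a, where a² = T² - 1

module SquareRoot {c ℓ} (R : CommutativeRing c ℓ) where
  open CommutativeRing R hiding (_-_; zero)
  open Notation rawRing using (_-_; #_; _^_)
  open Span rawRing using (T; next)
  open Solver R
  open SpanProperties R using (modulo)
  private
    module N₄ = Notation (termRing 4)
    module E₄ = Span (termRing 4)
    module N₅ = Notation (termRing 5)
    module N₂ = Notation (termRing 2)
    module E₂ = Span (termRing 2)

  -- This product is T² - 1, since (s + 1)(s + 4) = T - 1 and (s + 2)(s + 3) = T + 1.
  discriminant : Carrier → Carrier
  discriminant s = (s + # 1) * (s + # 2) * (s + # 3) * (s + # 4)

  module _ (s : Carrier) where
    private
      u : ℕ → Carrier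
      u n = ⟦ Terms.u n ⟧ (s ∷ [])

    -- Taken at a = α and a = -α it covers β and its conjugate together.
    power : ∀ a → a * a ≈ discriminant s → ∀ n →
      (T s + a) ^ n ≈ (u (suc n) - T s * u n) + u n * a
    power a a²≈ zero    = solve 2 (λ s a → N₂.1# ,
      (N₂.# 1 N₂.- E₂.T s N₂.* N₂.# 0) N₂.+ N₂.# 0 N₂.* a) ≡.refl s a
    -- Multiplying by T + a produces `u n` times a², hence the certificate `u n`; replacing a² by T²
    -- - 1 leaves the recurrence for `u`.
    power a a²≈ (suc n) = trans (*-congˡ (power a a²≈ n)) (modulo (u n) (sym a²≈)
      (solve 4 (λ s a x y →
        (E₄.T s N₄.+ a) N₄.* ((y N₄.- E₄.T s N₄.* x) N₄.+ x N₄.* a)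
          N₄.+ x N₄.* ((s N₄.+ N₄.# 1) N₄.* (s N₄.+ N₄.# 2) N₄.* (s N₄.+ N₄.# 3) N₄.* (s N₄.+ N₄.# 4)) ,
        ((E₄.next s x y N₄.- E₄.T s N₄.* y) N₄.+ y N₄.* a) N₄.+ x N₄.* (a N₄.* a))
        ≡.refl s a (u n) (u (suc n))))

    -- The two products are conjugate, so the parts even in `a` cancel and a factor 2a remains,
    -- which is the denominator of the closed formulas.
    power-difference : ∀ a → a * a ≈ discriminant s → ∀ A B n →
      (A + a * B) * (T s + a) ^ n - (A - a * B) * (T s - a) ^ n ≈
      (A * u n + B * (u (suc n) - T s * u n)) * (# 2 * a)
    power-difference a a²≈ A B n = trans
      (+-cong (*-congˡ (power a a²≈ n)) (-‿cong (*-congˡ (power (- a) (trans (-a*-a a) a²≈) n))))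
      (solve 5 (λ a A B x w →
        (A N₅.+ a N₅.* B) N₅.* (w N₅.+ x N₅.* a) N₅.- (A N₅.- a N₅.* B) N₅.* (w N₅.+ x N₅.* (N₅.- a)) ,
        (A N₅.* x N₅.+ B N₅.* w) N₅.* (N₅.# 2 N₅.* a)) ≡.refl a A B (u n) (u (suc n) - T s * u n))
      where
      -a*-a : ∀ a → - a * - a ≈ a * a
      -a*-a = solve 1 (λ a → N₁.- a N₁.* N₁.- a , a N₁.* a) ≡.refl
        where module N₁ = Notation (termRing 1)

-- The ring ℚ(t)(α) and division in it

module QuadraticExtensionProperties where
  private
    module K = CommutativeRing functionFieldCommutativeRing
    module F = Notation functionField
    module L = Notation quadraticExtension
    module N₃ = Notation (termRing 3)
    module N₅ = Notation (termRing 5)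
    module N₇ = Notation (termRing 7)
  open Solver functionFieldCommutativeRing using (solve)

  ≈ₗ-isEquivalence : IsEquivalence _≈ₗ_
  ≈ₗ-isEquivalence = record
    { refl  = mk≈ₗ K.refl K.refl
    ; sym   = λ x≈y → mk≈ₗ (K.sym (re≈ x≈y)) (K.sym (im≈ x≈y))
    ; trans = λ x≈y y≈z → mk≈ₗ (K.trans (re≈ x≈y) (re≈ y≈z)) (K.trans (im≈ x≈y) (im≈ y≈z))
    }

  -- The laws of multiplication are identities in which α² is just an indeterminate `d`, so the
  -- quartic under the root is never expanded.
  quadraticExtensionCommutativeRing : CommutativeRing _ _
  quadraticExtensionCommutativeRing = buildCommutativeRing quadraticExtension ≈ₗ-isEquivalence
    (λ x≈x′ y≈y′ → mk≈ₗ (K.+-cong (re≈ x≈x′) (re≈ y≈y′)) (K.+-cong (im≈ x≈x′) (im≈ y≈y′)))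
    (λ x y z → mk≈ₗ (K.+-assoc (re x) (re y) (re z)) (K.+-assoc (im x) (im y) (im z)))
    (λ x y → mk≈ₗ (K.+-comm (re x) (re y)) (K.+-comm (im x) (im y)))
    (λ x → mk≈ₗ (K.+-identityˡ (re x)) (K.+-identityˡ (im x)))
    (λ x≈y → mk≈ₗ (K.-‿cong (re≈ x≈y)) (K.-‿cong (im≈ x≈y)))
    (λ x → mk≈ₗ (K.-‿inverseˡ (re x)) (K.-‿inverseˡ (im x)))
    (λ {x} {x′} {y} {y′} x≈x′ y≈y′ → mk≈ₗ
      (K.+-cong (K.*-cong (re≈ x≈x′) (re≈ y≈y′)) (K.*-congˡ {α²} (K.*-cong (im≈ x≈x′) (im≈ y≈y′))))
      (K.+-cong (K.*-cong (re≈ x≈x′) (im≈ y≈y′)) (K.*-cong (im≈ x≈x′) (re≈ y≈y′))))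
    (λ x y z → mk≈ₗ
      (solve 7 (λ d a b c e f g →
        (a N₇.* c N₇.+ d N₇.* (b N₇.* e)) N₇.* f N₇.+ d N₇.* ((a N₇.* e N₇.+ b N₇.* c) N₇.* g) ,
        a N₇.* (c N₇.* f N₇.+ d N₇.* (e N₇.* g)) N₇.+ d N₇.* (b N₇.* (c N₇.* g N₇.+ e N₇.* f))) ≡.refl
        α² (re x) (im x) (re y) (im y) (re z) (im z))
      (solve 7 (λ d a b c e f g →
        (a N₇.* c N₇.+ d N₇.* (b N₇.* e)) N₇.* g N₇.+ (a N₇.* e N₇.+ b N₇.* c) N₇.* f ,
        a N₇.* (c N₇.* g N₇.+ e N₇.* f) N₇.+ b N₇.* (c N₇.* f N₇.+ d N₇.* (e N₇.* g))) ≡.refl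
        α² (re x) (im x) (re y) (im y) (re z) (im z)))
    (λ x y → mk≈ₗ
      (solve 5 (λ d a b c e → a N₅.* c N₅.+ d N₅.* (b N₅.* e) , c N₅.* a N₅.+ d N₅.* (e N₅.* b)) ≡.refl
        α² (re x) (im x) (re y) (im y))
      (solve 5 (λ d a b c e → a N₅.* e N₅.+ b N₅.* c , c N₅.* b N₅.+ e N₅.* a) ≡.refl
        α² (re x) (im x) (re y) (im y)))
    (λ x → mk≈ₗ
      (solve 3 (λ d a b → N₃.1# N₃.* a N₃.+ d N₃.* (N₃.0# N₃.* b) , a) ≡.refl α² (re x) (im x))
      (solve 3 (λ d a b → N₃.1# N₃.* b N₃.+ N₃.0# N₃.* a , b) ≡.refl α² (re x) (im x)))
    (λ z x y → mk≈ₗ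
      (solve 7 (λ d a b c e f g →
        (a N₇.+ c) N₇.* f N₇.+ d N₇.* ((b N₇.+ e) N₇.* g) ,
        (a N₇.* f N₇.+ d N₇.* (b N₇.* g)) N₇.+ (c N₇.* f N₇.+ d N₇.* (e N₇.* g))) ≡.refl
        α² (re x) (im x) (re y) (im y) (re z) (im z))
      (solve 7 (λ d a b c e f g →
        (a N₇.+ c) N₇.* g N₇.+ (b N₇.+ e) N₇.* f ,
        (a N₇.* g N₇.+ b N₇.* f) N₇.+ (c N₇.* g N₇.+ e N₇.* f)) ≡.refl
        α² (re x) (im x) (re y) (im y) (re z) (im z)))

  open RingMorphisms functionField quadraticExtension using (IsRingHomomorphism)

  fromK-isRingHomomorphism : IsRingHomomorphism fromK
  fromK-isRingHomomorphism = buildHomomorphism functionField quadraticExtension fromK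
    (λ x≈y → mk≈ₗ x≈y K.refl)
    (λ x y → mk≈ₗ K.refl (K.sym (K.+-identityˡ F.0#)))
    (λ x y → mk≈ₗ
      (solve 3 (λ d a b → a N₃.* b , a N₃.* b N₃.+ d N₃.* (N₃.0# N₃.* N₃.0#)) ≡.refl α² x y)
      (solve 3 (λ d a b → N₃.0# , a N₃.* N₃.0# N₃.+ N₃.0# N₃.* b) ≡.refl α² x y))
    (λ x → mk≈ₗ K.refl 0≈-0) (mk≈ₗ K.refl K.refl) (mk≈ₗ K.refl K.refl)
    where
    0≈-0 : F.0# K.≈ F.- F.0#
    0≈-0 = K.sym (K.trans (K.sym (K.+-identityˡ (F.- F.0#))) (K.-‿inverseʳ F.0#))

  private module L′ = CommutativeRing quadraticExtensionCommutativeRing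

  *-conjugate : ∀ y → y L.* mkQuad (re y) (F.- im y) L.≈ fromK (norm y)
  *-conjugate y = mk≈ₗ
    (solve 3 (λ d a b → a N₃.* a N₃.+ d N₃.* (b N₃.* (N₃.- b)) , a N₃.* a N₃.- d N₃.* (b N₃.* b)) ≡.refl α² (re y) (im y))
    (solve 3 (λ d a b → a N₃.* (N₃.- b) N₃.+ b N₃.* a , N₃.0#) ≡.refl α² (re y) (im y))

  divₗ-unique : ∀ x y z (h : norm y F.≉ F.0#) → x L.≈ z L.* y → divₗ x y h L.≈ z
  divₗ-unique x y z h x≈zy = begin
    x L.* ȳ L.* r           ≈⟨ L′.*-congʳ {r} (L′.*-congʳ {ȳ} x≈zy) ⟩
    z L.* y L.* ȳ L.* r     ≈⟨ L′.*-congʳ {r} (L′.*-assoc z y ȳ) ⟩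
    z L.* (y L.* ȳ) L.* r   ≈⟨ L′.*-assoc z (y L.* ȳ) r ⟩
    z L.* (y L.* ȳ L.* r)   ≈⟨ L′.*-congˡ {z} (L′.*-congʳ {r} (*-conjugate y)) ⟩
    z L.* (fromK (norm y) L.* r) ≈⟨ L′.*-congˡ {z} (*-homo (norm y) (recipₖ (norm y) h)) ⟨
    z L.* fromK (norm y F.* recipₖ (norm y) h) ≈⟨ L′.*-congˡ {z} (⟦⟧-cong (*-recipₖ (norm y) h)) ⟩
    z L.* L.1#              ≈⟨ L′.*-identityʳ z ⟩
    z                       ∎
    where
    open SetoidReasoning L′.setoid
    open RingMorphisms.IsRingHomomorphism fromK-isRingHomomorphism
    ȳ r : ℚ⟨t,α⟩
    ȳ = mkQuad (re y) (F.- im y)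
    r = fromK (recipₖ (norm y) h)

  -- α² is a product formed in ℚ(t), the discriminant one formed in the extension. Both are values
  -- of one term, matched by the homomorphism `fromK`.
  α*α : α L.* α L.≈ SquareRoot.discriminant quadraticExtensionCommutativeRing (fromK tₖ)
  α*α = L′.trans α*α≈α² (⟦⟧-homo fromK-isRingHomomorphism {ρ = tₖ ∷ []} {σ = fromK tₖ ∷ []} (λ { zero → L′.refl })
    (let open Notation (termRing 1) in
      (Terms.s + # 1) * (Terms.s + # 2) * (Terms.s + # 3) * (Terms.s + # 4)))
    where
    open Transport functionFieldCommutativeRing quadraticExtensionCommutativeRing
    α*α≈α² : α L.* α L.≈ fromK α²
    α*α≈α² = mk≈ₗ
      (solve 1 (λ d → N₁.0# N₁.* N₁.0# N₁.+ d N₁.* (N₁.1# N₁.* N₁.1#) , d) ≡.refl α²)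
      (solve 1 (λ d → N₁.0# N₁.* N₁.1# N₁.+ N₁.1# N₁.* N₁.0# , N₁.0#) ≡.refl α²)
      where module N₁ = Notation (termRing 1)

open QuadraticExtensionProperties

-- The closed formulas in terms of `u`

-- In ℚ(t)(α) the operations are functions that unfold, so the type checker cannot
-- compare two spellings of a cubic in reasonable time.  The module is therefore
-- parametrised by the spellings themselves, each with a proof of what it means.
module _ {c ℓ} (R : CommutativeRing c ℓ) where
  open CommutativeRing R using (rawRing)
  open Notation rawRing

  module ClosedForms (s a : Carrier) (a²≈ : a * a ≈ SquareRoot.discriminant R s)
    (numeral : ℕ → Carrier) (numeral≈ : ∀ k → numeral k ≈ # k)
    (s² s³ : Carrier) (s²≈ : s² ≈ s ^ 2) (s³≈ : s³ ≈ s ^ 3)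
    (linear : ℕ → Carrier) (linear≈ : ∀ k₀ → linear k₀ ≈ s + numeral k₀)
    (monic : ℕ → ℕ → ℕ → Carrier)
    (monic≈ : ∀ k₂ k₁ k₀ → monic k₂ k₁ k₀ ≈ s³ + numeral k₂ * s² + numeral k₁ * s + numeral k₀)
    (c₁ c₂ c₃ : ℕ → Carrier)
    (c₁≈ : ∀ k → c₁ k ≈ # k * s) (c₂≈ : ∀ k → c₂ k ≈ # k * s ^ 2) (c₃≈ : ∀ k → c₃ k ≈ # k * s ^ 3)
    (sum₄ : (x₁ x₂ x₃ x₄ : Carrier) → Carrier) (sum₄≈ : ∀ x₁ x₂ x₃ x₄ → sum₄ x₁ x₂ x₃ x₄ ≈ x₁ + x₂ + x₃ + x₄)
    (recurrenceStep : (x₁ x₂ x₃ y z : Carrier) → Carrier)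
    (recurrenceStep≈ : ∀ x₁ x₂ x₃ y z → recurrenceStep x₁ x₂ x₃ y z ≈ (x₁ + x₂ + x₃) * y - z)
    (b b̄ : Carrier) (b≈ : b ≈ Span.T rawRing s + a) (b̄≈ : b̄ ≈ Span.T rawRing s - a)
    where
    open CommutativeRing R using (trans; sym; +-cong; +-congʳ; +-congˡ; *-cong; *-congʳ; *-congˡ; -‿cong)
    open Span rawRing
    open Solver R
    open SpanProperties R using (span₁-recurrence; span₂-recurrence; span₃-recurrence; span₄-recurrence)
    open SquareRoot R using (power; power-difference)
    open Exp (CommutativeRing.semiring R) using (^-congˡ)
    private
      module N₁ = Notation (termRing 1)
      module E₁ = Span (termRing 1)
      module N₃ = Notation (termRing 3)
      module E₃ = Span (termRing 3)

    u : ℕ → Carrier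
    u n = ⟦ Terms.u n ⟧ (s ∷ [])

    quadratic-cong : ∀ {x y} k₂ k₁ k₀ → x ≈ y →
      x + numeral k₂ * s² + numeral k₁ * s + numeral k₀ ≈ y + # k₂ * s ^ 2 + # k₁ * s + # k₀
    quadratic-cong k₂ k₁ k₀ x≈y = +-cong (+-cong (+-cong x≈y (*-cong (numeral≈ k₂) s²≈))
      (*-congʳ (numeral≈ k₁))) (numeral≈ k₀)

    monic-canonical : ∀ k₂ k₁ k₀ → monic k₂ k₁ k₀ ≈ s ^ 3 + # k₂ * s ^ 2 + # k₁ * s + # k₀
    monic-canonical k₂ k₁ k₀ = trans (monic≈ k₂ k₁ k₀) (quadratic-cong k₂ k₁ k₀ s³≈)

    linear-canonical : ∀ k₀ → linear k₀ ≈ s + # k₀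
    linear-canonical k₀ = trans (linear≈ k₀) (+-congˡ (numeral≈ k₀))

    numerator : (A B : Carrier) → ℕ → Carrier
    numerator A B n = (A + a * B) * b ^ n - (A - a * B) * b̄ ^ n

    numerator≈ : ∀ {A B A′ B′} n → A ≈ A′ → B ≈ B′ →
      numerator A B n ≈ (A′ * u n + B′ * (u (suc n) - T s * u n)) * (# 2 * a)
    numerator≈ {A} {B} {A′} {B′} n A≈ B≈ = trans
      (+-cong (*-cong (+-cong A≈ (*-congˡ B≈)) (^-congˡ n b≈))
        (-‿cong (*-cong (+-cong A≈ (-‿cong (*-congˡ B≈))) (^-congˡ n b̄≈))))
      (power-difference s a a²≈ A′ B′ n)

    -- Origin of the cubics: the i-th one is T Bᵢ + Cᵢ, here T (s + 1) - (s + 4). Then A x + B (y -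
    -- T x) collapses to B y + C x, the coordinate of the span; the other three coordinates work
    -- alike.
    numerator₁ : ∀ n → numerator (monic 6 9 1) (linear 1) n ≈ ⟦ Terms.x₁ n ⟧ (s ∷ []) * (# 2 * a)
    numerator₁ n = trans (numerator≈ n (monic-canonical 6 9 1) (linear-canonical 1)) (*-congʳ (solve 3 (λ s x y →
      (s N₃.^ 3 N₃.+ N₃.# 6 N₃.* s N₃.^ 2 N₃.+ N₃.# 9 N₃.* s N₃.+ N₃.# 1) N₃.* x
        N₃.+ (s N₃.+ N₃.# 1) N₃.* (y N₃.- E₃.T s N₃.* x) , E₃.span₁ s y x) ≡.refl s (u n) (u (suc n))))

    numerator₂ : ∀ n → numerator (monic 7 16 13) (linear 2) n ≈ ⟦ Terms.x₂ n ⟧ (s ∷ []) * (# 2 * a)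
    numerator₂ n = trans (numerator≈ n (monic-canonical 7 16 13) (linear-canonical 2)) (*-congʳ (solve 3 (λ s x y →
      (s N₃.^ 3 N₃.+ N₃.# 7 N₃.* s N₃.^ 2 N₃.+ N₃.# 16 N₃.* s N₃.+ N₃.# 13) N₃.* x
        N₃.+ (s N₃.+ N₃.# 2) N₃.* (y N₃.- E₃.T s N₃.* x) , E₃.span₂ s y x) ≡.refl s (u n) (u (suc n))))

    numerator₃ : ∀ n → numerator (monic 8 21 17) (linear 3) n ≈ ⟦ Terms.x₃ n ⟧ (s ∷ []) * (# 2 * a)
    numerator₃ n = trans (numerator≈ n (monic-canonical 8 21 17) (linear-canonical 3)) (*-congʳ (solve 3 (λ s x y →
      (s N₃.^ 3 N₃.+ N₃.# 8 N₃.* s N₃.^ 2 N₃.+ N₃.# 21 N₃.* s N₃.+ N₃.# 17) N₃.* x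
        N₃.+ (s N₃.+ N₃.# 3) N₃.* (y N₃.- E₃.T s N₃.* x) , E₃.span₃ s y x) ≡.refl s (u n) (u (suc n))))

    numerator₄ : ∀ n → numerator (monic 9 24 19) (linear 4) n ≈ ⟦ Terms.x₄ n ⟧ (s ∷ []) * (# 2 * a)
    numerator₄ n = trans (numerator≈ n (monic-canonical 9 24 19) (linear-canonical 4)) (*-congʳ (solve 3 (λ s x y →
      (s N₃.^ 3 N₃.+ N₃.# 9 N₃.* s N₃.^ 2 N₃.+ N₃.# 24 N₃.* s N₃.+ N₃.# 19) N₃.* x
        N₃.+ (s N₃.+ N₃.# 4) N₃.* (y N₃.- E₃.T s N₃.* x) , E₃.span₄ s y x) ≡.refl s (u n) (u (suc n))))

    module Values (ξ₁ ξ₂ ξ₃ ξ₄ : ℕ → Carrier)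
      (ξ₁≈ : ∀ n → ξ₁ n ≈ ⟦ Terms.x₁ n ⟧ (s ∷ [])) (ξ₂≈ : ∀ n → ξ₂ n ≈ ⟦ Terms.x₂ n ⟧ (s ∷ []))
      (ξ₃≈ : ∀ n → ξ₃ n ≈ ⟦ Terms.x₃ n ⟧ (s ∷ [])) (ξ₄≈ : ∀ n → ξ₄ n ≈ ⟦ Terms.x₄ n ⟧ (s ∷ []))
      where

      -- Carries the recurrence from term values to the sequences ξᵢ and respells 2T as f(t) = 2t² +
      -- 10t + 10.
      transfer : ∀ {x₀ x₁ x₂ y₀ y₁ y₂} → x₀ ≈ y₀ → x₁ ≈ y₁ → x₂ ≈ y₂ →
        y₂ ≈ # 2 * T s * y₁ - y₀ → x₂ ≈ recurrenceStep (c₂ 2) (c₁ 10) (numeral 10) x₁ x₀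
      transfer x₀≈ x₁≈ x₂≈ y₂≈ = trans x₂≈ (trans y₂≈
        (trans (+-cong (*-cong 2T≈ (sym x₁≈)) (-‿cong (sym x₀≈))) (sym (recurrenceStep≈ (c₂ 2) (c₁ 10) (numeral 10) _ _))))
        where
        2T≈ : # 2 * T s ≈ c₂ 2 + c₁ 10 + numeral 10
        2T≈ = trans
          (solve 1 (λ s → N₁.# 2 N₁.* E₁.T s , N₁.# 2 N₁.* s N₁.^ 2 N₁.+ N₁.# 10 N₁.* s N₁.+ N₁.# 10) ≡.refl s)
          (sym (+-cong (+-cong (c₂≈ 2) (c₁≈ 10)) (numeral≈ 10)))

      ξ₁-zero : ξ₁ 0 ≈ linear 1
      ξ₁-zero = trans (ξ₁≈ 0) (trans
        (solve 1 (λ s → E₁.span₁ s (N₁.# 1) (N₁.# 0) , s N₁.+ N₁.# 1) ≡.refl s) (sym (linear-canonical 1)))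

      -- Since u 1 = 1 and u 2 = 2T, the cubic is 2T B₁ + C₁ expanded.
      ξ₁-one : ξ₁ 1 ≈ sum₄ (c₃ 2) (c₂ 12) (c₁ 19) (numeral 6)
      ξ₁-one = trans (ξ₁≈ 1) (trans (solve 1 (λ s → E₁.span₁ s (E₁.next s (N₁.# 0) (N₁.# 1)) (N₁.# 1) ,
        N₁.# 2 N₁.* s N₁.^ 3 N₁.+ N₁.# 12 N₁.* s N₁.^ 2 N₁.+ N₁.# 19 N₁.* s N₁.+ N₁.# 6) ≡.refl s)
        (sym (trans (sum₄≈ (c₃ 2) (c₂ 12) (c₁ 19) (numeral 6)) (+-cong (+-cong (+-cong (c₃≈ 2) (c₂≈ 12)) (c₁≈ 19)) (numeral≈ 6)))))

      ξ₁-recurrence : ∀ n → ξ₁ (2 ℕ.+ n) ≈ recurrenceStep (c₂ 2) (c₁ 10) (numeral 10) (ξ₁ (suc n)) (ξ₁ n)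
      ξ₁-recurrence n = transfer (ξ₁≈ n) (ξ₁≈ (suc n)) (ξ₁≈ (2 ℕ.+ n)) (span₁-recurrence s (u n) (u (suc n)))

      ξ₂-zero : ξ₂ 0 ≈ linear 2
      ξ₂-zero = trans (ξ₂≈ 0) (trans
        (solve 1 (λ s → E₁.span₂ s (N₁.# 1) (N₁.# 0) , s N₁.+ N₁.# 2) ≡.refl s) (sym (linear-canonical 2)))

      ξ₂-one : ξ₂ 1 ≈ sum₄ (c₃ 2) (c₂ 14) (c₁ 31) (numeral 23)
      ξ₂-one = trans (ξ₂≈ 1) (trans (solve 1 (λ s → E₁.span₂ s (E₁.next s (N₁.# 0) (N₁.# 1)) (N₁.# 1) ,
        N₁.# 2 N₁.* s N₁.^ 3 N₁.+ N₁.# 14 N₁.* s N₁.^ 2 N₁.+ N₁.# 31 N₁.* s N₁.+ N₁.# 23) ≡.refl s)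
        (sym (trans (sum₄≈ (c₃ 2) (c₂ 14) (c₁ 31) (numeral 23)) (+-cong (+-cong (+-cong (c₃≈ 2) (c₂≈ 14)) (c₁≈ 31)) (numeral≈ 23)))))

      ξ₂-recurrence : ∀ n → ξ₂ (2 ℕ.+ n) ≈ recurrenceStep (c₂ 2) (c₁ 10) (numeral 10) (ξ₂ (suc n)) (ξ₂ n)
      ξ₂-recurrence n = transfer (ξ₂≈ n) (ξ₂≈ (suc n)) (ξ₂≈ (2 ℕ.+ n)) (span₂-recurrence s (u n) (u (suc n)))

      ξ₃-zero : ξ₃ 0 ≈ linear 3
      ξ₃-zero = trans (ξ₃≈ 0) (trans
        (solve 1 (λ s → E₁.span₃ s (N₁.# 1) (N₁.# 0) , s N₁.+ N₁.# 3) ≡.refl s) (sym (linear-canonical 3)))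

      ξ₃-one : ξ₃ 1 ≈ sum₄ (c₃ 2) (c₂ 16) (c₁ 41) (numeral 32)
      ξ₃-one = trans (ξ₃≈ 1) (trans (solve 1 (λ s → E₁.span₃ s (E₁.next s (N₁.# 0) (N₁.# 1)) (N₁.# 1) ,
        N₁.# 2 N₁.* s N₁.^ 3 N₁.+ N₁.# 16 N₁.* s N₁.^ 2 N₁.+ N₁.# 41 N₁.* s N₁.+ N₁.# 32) ≡.refl s)
        (sym (trans (sum₄≈ (c₃ 2) (c₂ 16) (c₁ 41) (numeral 32)) (+-cong (+-cong (+-cong (c₃≈ 2) (c₂≈ 16)) (c₁≈ 41)) (numeral≈ 32)))))

      ξ₃-recurrence : ∀ n → ξ₃ (2 ℕ.+ n) ≈ recurrenceStep (c₂ 2) (c₁ 10) (numeral 10) (ξ₃ (suc n)) (ξ₃ n)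
      ξ₃-recurrence n = transfer (ξ₃≈ n) (ξ₃≈ (suc n)) (ξ₃≈ (2 ℕ.+ n)) (span₃-recurrence s (u n) (u (suc n)))

      ξ₄-zero : ξ₄ 0 ≈ linear 4
      ξ₄-zero = trans (ξ₄≈ 0) (trans
        (solve 1 (λ s → E₁.span₄ s (N₁.# 1) (N₁.# 0) , s N₁.+ N₁.# 4) ≡.refl s) (sym (linear-canonical 4)))

      ξ₄-one : ξ₄ 1 ≈ sum₄ (c₃ 2) (c₂ 18) (c₁ 49) (numeral 39)
      ξ₄-one = trans (ξ₄≈ 1) (trans (solve 1 (λ s → E₁.span₄ s (E₁.next s (N₁.# 0) (N₁.# 1)) (N₁.# 1) ,
        N₁.# 2 N₁.* s N₁.^ 3 N₁.+ N₁.# 18 N₁.* s N₁.^ 2 N₁.+ N₁.# 49 N₁.* s N₁.+ N₁.# 39) ≡.refl s)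
        (sym (trans (sum₄≈ (c₃ 2) (c₂ 18) (c₁ 49) (numeral 39)) (+-cong (+-cong (+-cong (c₃≈ 2) (c₂≈ 18)) (c₁≈ 49)) (numeral≈ 39)))))

      ξ₄-recurrence : ∀ n → ξ₄ (2 ℕ.+ n) ≈ recurrenceStep (c₂ 2) (c₁ 10) (numeral 10) (ξ₄ (suc n)) (ξ₄ n)
      ξ₄-recurrence n = transfer (ξ₄≈ n) (ξ₄≈ (suc n)) (ξ₄≈ (2 ℕ.+ n)) (span₄-recurrence s (u n) (u (suc n)))

-- The orbit of `P₀` under ζ

module Orbit where
  open Notation functionField using (_≈_; _≉_; -_; 0#)
  private
    module P = CommutativeRing polynomialCommutativeRing
    module F = CommutativeRing functionFieldCommutativeRing
  open Span polynomialRing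
  open SpanProperties polynomialCommutativeRing using
    (φ₁-span; φ₂-span; φ₃-span; φ₄-span; form-u; form-swap; span∈X₄; swap₁; swap₂; swap₃; swap₄)
  open Transport polynomialCommutativeRing functionFieldCommutativeRing
  open RingMorphisms.IsRingHomomorphism fromPoly-isRingHomomorphism using (⟦⟧-cong; *-homo)

  infix 4 _≈ₚₜ_
  -- Iterating ζ piles up uncancelled denominators, so iterates match polynomial points only up to
  -- the equality of fractions.
  _≈ₚₜ_ : Point → Vec ℚ[t] 4 → Set
  P ≈ₚₜ p = Pointwise _≈_ P (Vec.map fromPoly p)

  u : ℕ → ℚ[t]
  u n = Solver.⟦_⟧ polynomialCommutativeRing (Terms.u n) (tₚ ∷ [])

  orbit : ℕ → Vec ℚ[t] 4
  orbit n = span tₚ (u (suc n)) (u n)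

  orbit∈X₄ : ∀ n P → P ≈ₚₜ orbit n → X₄ P
  orbit∈X₄ n P P≈ = InX₄-homo fromPoly-isRingHomomorphism (orbit n) P P≈
    (span∈X₄ {tₚ} {u (suc n)} {u n} (P.trans (form-swap tₚ (u (suc n)) (u n)) (form-u tₚ n)))

  module _ (n : ℕ) where
    reflected : Vec ℚ[t] 4
    reflected = span tₚ (u n) (u (suc n))

    module _ (P : Point) (P≈ : P ≈ₚₜ reflected) where
      P∈X₄ : X₄ P
      P∈X₄ = InX₄-homo fromPoly-isRingHomomorphism reflected P P≈
        (span∈X₄ {tₚ} {u n} {u (suc n)} (form-u tₚ n))

      Q≈ : q functionField P ≈ fromPoly (q polynomialRing reflected)
      Q≈ = q-homo fromPoly-isRingHomomorphism reflected P P≈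

      Q≉0 : q functionField P ≉ 0#
      Q≉0 Q≈0 = q≉0 n (fromPoly-injective {q polynomialRing reflected} {[]} (F.trans (F.sym Q≈) Q≈0))

      quotient : ∀ x p r → x ≈ fromPoly p → p P.≈ q polynomialRing reflected P.* r →
        divₖ x (q functionField P) Q≉0 ≈ fromPoly r
      quotient x p r x≈p p≈qr = divₖ-unique Q≉0
        (F.trans x≈p (F.trans (⟦⟧-cong p≈qr)
          (F.trans (*-homo (q polynomialRing reflected) r) (F.*-congʳ {fromPoly r} (F.sym Q≈)))))

      -- `next tₚ (u n) (u (suc n))` is `u (suc (suc n))` by definition, so the right sides of
      -- `φ₁-span` to `φ₄-span` already contain the coordinates of `orbit (suc n)`.
      φ-reflected : Σ (Dom φ P) λ h → apply φ P h ≈ₚₜ orbit (suc n)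
      φ-reflected = (P∈X₄ , Q≉0) ,
        quotient (p₁ functionField P) (p₁ polynomialRing reflected) (span₁ tₚ (u (suc (suc n))) (u (suc n)))
          (p₁-homo fromPoly-isRingHomomorphism reflected P P≈) (φ₁-span tₚ (u n) (u (suc n)) (form-u tₚ n)) ∷
        quotient (p₂ functionField P) (p₂ polynomialRing reflected) (span₂ tₚ (u (suc (suc n))) (u (suc n)))
          (p₂-homo fromPoly-isRingHomomorphism reflected P P≈) (φ₂-span tₚ (u n) (u (suc n)) (form-u tₚ n)) ∷
        quotient (p₃ functionField P) (p₃ polynomialRing reflected) (span₃ tₚ (u (suc (suc n))) (u (suc n)))
          (p₃-homo fromPoly-isRingHomomorphism reflected P P≈) (φ₃-span tₚ (u n) (u (suc n)) (form-u tₚ n)) ∷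
        quotient (p₄ functionField P) (p₄ polynomialRing reflected) (span₄ tₚ (u (suc (suc n))) (u (suc n)))
          (p₄-homo fromPoly-isRingHomomorphism reflected P P≈) (φ₄-span tₚ (u n) (u (suc n)) (form-u tₚ n)) ∷ []

  ζ-orbit : ∀ n P → P ≈ₚₜ orbit n → Σ (Dom ζ P) λ h → apply ζ P h ≈ₚₜ orbit (suc n)
  -- The underscore stands for the unit domains of `μ₁₄` and `τ`.
  ζ-orbit n (a ∷ b ∷ c ∷ d ∷ []) (a≈ ∷ b≈ ∷ c≈ ∷ d≈ ∷ []) = (_ , proj₁ φP) , proj₂ φP
    where
    φP = φ-reflected n (- d ∷ c ∷ b ∷ - a ∷ [])
      (F.trans (F.-‿cong d≈) (mk≈ₖ-cong (swap₁ tₚ (u n) (u (suc n)))) ∷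
       F.trans c≈ (mk≈ₖ-cong (swap₂ tₚ (u n) (u (suc n)))) ∷
       F.trans b≈ (mk≈ₖ-cong (swap₃ tₚ (u n) (u (suc n)))) ∷
       F.trans (F.-‿cong a≈) (mk≈ₖ-cong (swap₄ tₚ (u n) (u (suc n)))) ∷ [])
      where
      mk≈ₖ-cong : ∀ {p r} → p P.≈ r → fromPoly p ≈ fromPoly r
      mk≈ₖ-cong = ⟦⟧-cong

  P₀-orbit : P₀ ≈ₚₜ orbit 0
  P₀-orbit = F.sym at₁ ∷ F.sym at₂ ∷ F.sym at₃ ∷ F.sym at₄ ∷ []
    where
    open Notation functionField using (_+_; #_)
    module N₁ = Notation (termRing 1)
    module E₁ = Span (termRing 1)
    open Solver functionFieldCommutativeRing using (solve; ⟦_⟧)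

    value : ∀ e → fromPoly (Solver.⟦_⟧ polynomialCommutativeRing e (tₚ ∷ [])) ≈ ⟦ e ⟧ (tₖ ∷ [])
    value = ⟦⟧-homo fromPoly-isRingHomomorphism λ { zero → F.refl }

    at₁ : fromPoly (span₁ tₚ (u 1) (u 0)) ≈ tₖ + # 1
    at₁ = F.trans (value (Terms.x₁ 0)) (solve 1 (λ s → E₁.span₁ s (N₁.# 1) (N₁.# 0) , s N₁.+ N₁.# 1) ≡.refl tₖ)

    at₂ : fromPoly (span₂ tₚ (u 1) (u 0)) ≈ tₖ + # 2
    at₂ = F.trans (value (Terms.x₂ 0)) (solve 1 (λ s → E₁.span₂ s (N₁.# 1) (N₁.# 0) , s N₁.+ N₁.# 2) ≡.refl tₖ)

    at₃ : fromPoly (span₃ tₚ (u 1) (u 0)) ≈ tₖ + # 3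
    at₃ = F.trans (value (Terms.x₃ 0)) (solve 1 (λ s → E₁.span₃ s (N₁.# 1) (N₁.# 0) , s N₁.+ N₁.# 3) ≡.refl tₖ)

    at₄ : fromPoly (span₄ tₚ (u 1) (u 0)) ≈ tₖ + # 4
    at₄ = F.trans (value (Terms.x₄ 0)) (solve 1 (λ s → E₁.span₄ s (N₁.# 1) (N₁.# 0) , s N₁.+ N₁.# 4) ≡.refl tₖ)

  -- Definedness and value go through one induction: ζ applies to the current iterate because that
  -- iterate is known to be an orbit point.
  iterate-orbit : ∀ n → Σ (Dom (iterate ζ n) P₀) λ h → apply (iterate ζ n) P₀ h ≈ₚₜ orbit n
  iterate-orbit zero    = tt , P₀-orbit
  iterate-orbit (suc n) = (h , proj₁ ζP) , proj₂ ζP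
    where
    h = proj₁ (iterate-orbit n)
    ζP = ζ-orbit n (apply (iterate ζ n) P₀ h) (proj₂ (iterate-orbit n))

-- The six claims for ξ

open import Defs
open import Data.Integer.Base using (ℤ)
open import Data.Integer.Properties using (+-*-commutativeRing)
open import Data.Nat.Base as ℕ using (ℕ; suc)
open import Data.Product.Base using (Σ; ∃; _×_; _,_)
open import Data.Rational.Base as ℚ using (ℚ)
open import Data.Vec.Base as Vec using (Vec; []; _∷_)
open import Data.Vec.Relation.Unary.All using (All)
open import Relation.Binary.PropositionalEquality using (_≡_)

private
  module L = CommutativeRing quadraticExtensionCommutativeRing
  module F = CommutativeRing functionFieldCommutativeRing
  module ⟦L⟧ = Solver quadraticExtensionCommutativeRing
  module ⟦K⟧ = Solver functionFieldCommutativeRing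
  module ⟦ℚ[t]⟧ = Solver polynomialCommutativeRing
  module ⟦ℤ⟧ = Solver +-*-commutativeRing

-- Named expressions and sequences ℕ → ℚ⟨t,α⟩ keep the type checker from expanding
-- elements of ℚ⟨t,α⟩ into their coordinates.
sum₄ : (x₁ x₂ x₃ x₄ : ℚ⟨t,α⟩) → ℚ⟨t,α⟩
sum₄ x₁ x₂ x₃ x₄ = x₁ + x₂ + x₃ + x₄

recurrenceStep : (x₁ x₂ x₃ y z : ℚ⟨t,α⟩) → ℚ⟨t,α⟩
recurrenceStep x₁ x₂ x₃ y z = (x₁ + x₂ + x₃) * y - z

monomial₀ monomial₁ monomial₂ monomial₃ : ℕ → ℚ⟨t,α⟩
monomial₀ k = # k
monomial₁ k = # k * t
monomial₂ k = # k * t ^ 2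
monomial₃ k = # k * t ^ 3

private
  module CF = ClosedForms quadraticExtensionCommutativeRing t α α*α
    monomial₀ (λ k → L.refl) (t ^ 2) (t ^ 3) L.refl L.refl
    (λ k₀ → t + # k₀) (λ k₀ → L.refl)
    (λ k₂ k₁ k₀ → t ^ 3 + # k₂ * t ^ 2 + # k₁ * t + # k₀) (λ k₂ k₁ k₀ → L.refl)
    monomial₁ monomial₂ monomial₃ (λ k → L.refl) (λ k → L.refl) (λ k → L.refl)
    sum₄ (λ _ _ _ _ → L.refl) recurrenceStep (λ _ _ _ _ _ → L.refl) β β̄ L.refl L.refl

-- The summands are variables here, so matching on `≡.refl` exchanges one spelling for the other
-- without unfolding the arithmetic of the extension.
cubic-spelling : ∀ x p q r w {k₃ k₂ k₁ k₀} →
  p ≡ # k₃ * t ^ 3 → q ≡ # k₂ * t ^ 2 → r ≡ # k₁ * t → w ≡ # k₀ →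
  x ≈ sum₄ p q r w → x ≈ # k₃ * t ^ 3 + # k₂ * t ^ 2 + # k₁ * t + # k₀
cubic-spelling x p q r w ≡.refl ≡.refl ≡.refl ≡.refl eq = eq

quadratic-spelling : ∀ x y z p q r {k₂ k₁ k₀} → p ≡ # k₂ * t ^ 2 → q ≡ # k₁ * t → r ≡ # k₀ →
  x ≈ recurrenceStep p q r y z → x ≈ (# k₂ * t ^ 2 + # k₁ * t + # k₀) * y - z
quadratic-spelling x y z p q r ≡.refl ≡.refl ≡.refl eq = eq

monomial₀≡ : ∀ k → monomial₀ k ≡ # k
monomial₀≡ k = ≡.refl

monomial₁≡ : ∀ k → monomial₁ k ≡ # k * t
monomial₁≡ k = ≡.refl

monomial₂≡ : ∀ k → monomial₂ k ≡ # k * t ^ 2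
monomial₂≡ k = ≡.refl

monomial₃≡ : ∀ k → monomial₃ k ≡ # k * t ^ 3
monomial₃≡ k = ≡.refl

cubic-respell : (x : ℕ → ℚ⟨t,α⟩) → ∀ k₂ k₁ k₀ →
  x 1 ≈ sum₄ (monomial₃ 2) (monomial₂ k₂) (monomial₁ k₁) (monomial₀ k₀) →
  x 1 ≈ # 2 * t ^ 3 + # k₂ * t ^ 2 + # k₁ * t + # k₀
cubic-respell x k₂ k₁ k₀ = cubic-spelling (x 1)
  (monomial₃ 2) (monomial₂ k₂) (monomial₁ k₁) (monomial₀ k₀) {2} {k₂} {k₁} {k₀}
  (monomial₃≡ 2) (monomial₂≡ k₂) (monomial₁≡ k₁) (monomial₀≡ k₀)

recurrence-respell : (x : ℕ → ℚ⟨t,α⟩) →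
  (∀ n → x (2 ℕ.+ n) ≈ recurrenceStep (monomial₂ 2) (monomial₁ 10) (monomial₀ 10) (x (suc n)) (x n)) →
  ∀ n → x (2 ℕ.+ n) ≈ (# 2 * t ^ 2 + # 10 * t + # 10) * x (suc n) - x n
recurrence-respell x eq n = quadratic-spelling (x (2 ℕ.+ n)) (x (suc n)) (x n)
  (monomial₂ 2) (monomial₁ 10) (monomial₀ 10) {2} {10} {10}
  (monomial₂≡ 2) (monomial₁≡ 10) (monomial₀≡ 10) (eq n)

polynomial : Term 1 → ℚ[t]
polynomial e = ⟦ℚ[t]⟧.⟦ e ⟧ (tₚ ∷ [])

closedForm-unique : ∀ A B n z → CF.numerator A B n ≈ z * (# 2 * α) → closedForm A B n ≈ z
closedForm-unique A B n z = divₗ-unique ((A + α * B) * β ^ n - (A - α * B) * β̄ ^ n) (# 2 * α) z norm2α≉0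

ξ₁≈ : ∀ n → ξ₁ n ≈ ⟦L⟧.⟦ Terms.x₁ n ⟧ (t ∷ [])
ξ₁≈ n = closedForm-unique (t ^ 3 + # 6 * t ^ 2 + # 9 * t + # 1) (t + # 1) n
  (⟦L⟧.⟦ Terms.x₁ n ⟧ (t ∷ [])) (CF.numerator₁ n)

ξ₂≈ : ∀ n → ξ₂ n ≈ ⟦L⟧.⟦ Terms.x₂ n ⟧ (t ∷ [])
ξ₂≈ n = closedForm-unique (t ^ 3 + # 7 * t ^ 2 + # 16 * t + # 13) (t + # 2) n
  (⟦L⟧.⟦ Terms.x₂ n ⟧ (t ∷ [])) (CF.numerator₂ n)

ξ₃≈ : ∀ n → ξ₃ n ≈ ⟦L⟧.⟦ Terms.x₃ n ⟧ (t ∷ [])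
ξ₃≈ n = closedForm-unique (t ^ 3 + # 8 * t ^ 2 + # 21 * t + # 17) (t + # 3) n
  (⟦L⟧.⟦ Terms.x₃ n ⟧ (t ∷ [])) (CF.numerator₃ n)

ξ₄≈ : ∀ n → ξ₄ n ≈ ⟦L⟧.⟦ Terms.x₄ n ⟧ (t ∷ [])
ξ₄≈ n = closedForm-unique (t ^ 3 + # 9 * t ^ 2 + # 24 * t + # 19) (t + # 4) n
  (⟦L⟧.⟦ Terms.x₄ n ⟧ (t ∷ [])) (CF.numerator₄ n)

private
  module V = CF.Values ξ₁ ξ₂ ξ₃ ξ₄ ξ₁≈ ξ₂≈ ξ₃≈ ξ₄≈

ξ-zero : ξ 0 ≋ t + # 1 ∷ t + # 2 ∷ t + # 3 ∷ t + # 4 ∷ []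
ξ-zero = V.ξ₁-zero ∷ V.ξ₂-zero ∷ V.ξ₃-zero ∷ V.ξ₄-zero ∷ []

ξ-one : ξ 1 ≋ # 2 * t ^ 3 + # 12 * t ^ 2 + # 19 * t + # 6
            ∷ # 2 * t ^ 3 + # 14 * t ^ 2 + # 31 * t + # 23
            ∷ # 2 * t ^ 3 + # 16 * t ^ 2 + # 41 * t + # 32
            ∷ # 2 * t ^ 3 + # 18 * t ^ 2 + # 49 * t + # 39
            ∷ []
ξ-one =
  cubic-respell ξ₁ 12 19 6 V.ξ₁-one ∷ cubic-respell ξ₂ 14 31 23 V.ξ₂-one ∷
  cubic-respell ξ₃ 16 41 32 V.ξ₃-one ∷ cubic-respell ξ₄ 18 49 39 V.ξ₄-one ∷ []

ξ-recurrence : ∀ n →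
  ξ (2 ℕ.+ n) ≋ Vec.zipWith (λ x y → (# 2 * t ^ 2 + # 10 * t + # 10) * x - y) (ξ (suc n)) (ξ n)
ξ-recurrence n =
  recurrence-respell ξ₁ V.ξ₁-recurrence n ∷
  recurrence-respell ξ₂ V.ξ₂-recurrence n ∷
  recurrence-respell ξ₃ V.ξ₃-recurrence n ∷
  recurrence-respell ξ₄ V.ξ₄-recurrence n ∷ []

fromPoly-polynomial : ∀ e → fromPoly (polynomial e) K.≈ ⟦K⟧.⟦ e ⟧ (tₖ ∷ [])
fromPoly-polynomial = ⟦⟧-homo fromPoly-isRingHomomorphism λ { zero → F.refl }
  where open Transport polynomialCommutativeRing functionFieldCommutativeRing

-- One term is evaluated in ℚ[t], ℚ(t) and ℚ(t)(α) and the values are matched; this is why α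
-- disappears from the coordinates of ξ.
fromK-polynomial : ∀ e → ⟦L⟧.⟦ e ⟧ (t ∷ []) ≈ fromK (fromPoly (polynomial e))
fromK-polynomial e = L.sym (L.trans (mk≈ₗ (fromPoly-polynomial e) F.refl)
  (⟦⟧-homo fromK-isRingHomomorphism {ρ = tₖ ∷ []} (λ { zero → L.refl }) e))
  where open Transport functionFieldCommutativeRing quadraticExtensionCommutativeRing

module _ (x : ℕ → ℚ⟨t,α⟩) (e : ℕ → Term 1) (x≈e : ∀ n → x n ≈ ⟦L⟧.⟦ e n ⟧ (t ∷ [])) where

  x≈polynomial : ∀ n → x n ≈ fromK (fromPoly (polynomial (e n)))
  x≈polynomial n = L.trans (x≈e n) (fromK-polynomial (e n))

  fromK-value : ∀ n a → a ≈ₖ fromPoly (polynomial (e n)) → fromK a ≈ x n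
  fromK-value n a a≈ = L.trans (mk≈ₗ a≈ F.refl) (L.sym (x≈polynomial n))

  -- The Büchi claim concerns every polynomial tuple that represents ξ n. Since `fromPoly` and
  -- `fromK` are injective, such a tuple agrees with the one given by the terms.
  polynomial-unique : ∀ n r → x n ≈ fromK (fromPoly r) → r ≈ₚ polynomial (e n)
  polynomial-unique n r x≈r = fromPoly-injective (F.trans (F.sym (re≈ x≈r)) (re≈ (x≈polynomial n)))

ξ-polynomials : ∀ n → IsPolyTuple (ξ n) (Vec.map polynomial (Terms.x n))
ξ-polynomials n =
  x≈polynomial ξ₁ Terms.x₁ ξ₁≈ n ∷ x≈polynomial ξ₂ Terms.x₂ ξ₂≈ n ∷
  x≈polynomial ξ₃ Terms.x₃ ξ₃≈ n ∷ x≈polynomial ξ₄ Terms.x₄ ξ₄≈ n ∷ []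

polynomials-degree : ∀ n → All (λ r → HasDegree r (2 ℕ.* n ℕ.+ 1)) (Vec.map polynomial (Terms.x n))
polynomials-degree n =
  commute (λ k → polynomial (Terms.x₁ k)) Degrees.span₁-degree ∷
  commute (λ k → polynomial (Terms.x₂ k)) Degrees.span₂-degree ∷
  commute (λ k → polynomial (Terms.x₃ k)) Degrees.span₃-degree ∷
  commute (λ k → polynomial (Terms.x₄ k)) Degrees.span₄-degree ∷ []
  where
  commute : ∀ p → (∀ k → HasDegree (p k) (k ℕ.* 2 ℕ.+ 1)) → HasDegree (p n) (2 ℕ.* n ℕ.+ 1)
  -- The degree recurrence counts `k * 2`, the claim `2 * n`.
  commute p degree = ≡.subst (λ k → HasDegree (p n) (k ℕ.+ 1)) (ℕ.*-comm n 2) (degree n)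

-- Evaluation ℚ[t] → ℚ at s and the inclusion ℤ → ℚ are both homomorphisms, so the two values of the
-- term meet in ℚ.
eval-polynomial : ∀ e s → eval (polynomial e) (s ℚ./ 1) ≡ ⟦ℤ⟧.⟦ e ⟧ (s ∷ []) ℚ./ 1
eval-polynomial e s = ≡.trans
  (Transport.⟦⟧-homo polynomialCommutativeRing ℚ.+-*-commutativeRing
    (eval-isRingHomomorphism (s ℚ./ 1)) {ρ = tₚ ∷ []} {σ = s ℚ./ 1 ∷ []} (λ { zero → eval-t (s ℚ./ 1) }) e)
  (≡.sym (Transport.⟦⟧-homo +-*-commutativeRing ℚ.+-*-commutativeRing
    /1-isRingHomomorphism (λ { zero → ≡.refl }) e))
  where
  eval-t : ∀ x → eval tₚ x ≡ x
  eval-t x = begin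
    ℚ.0ℚ ℚ.+ x ℚ.* (ℚ.1ℚ ℚ.+ x ℚ.* ℚ.0ℚ)  ≡⟨ ℚ.+-identityˡ _ ⟩
    x ℚ.* (ℚ.1ℚ ℚ.+ x ℚ.* ℚ.0ℚ)           ≡⟨ ≡.cong (λ y → x ℚ.* (ℚ.1ℚ ℚ.+ y)) (ℚ.*-zeroʳ x) ⟩
    x ℚ.* (ℚ.1ℚ ℚ.+ ℚ.0ℚ)                 ≡⟨ ≡.cong (x ℚ.*_) (ℚ.+-identityʳ ℚ.1ℚ) ⟩
    x ℚ.* ℚ.1ℚ                            ≡⟨ ℚ.*-identityʳ x ⟩
    x                                     ∎
    where open ≡.≡-Reasoning

eval-polynomials : ∀ {k} (p : Vec ℚ[t] k) (e : Vec (Term 1) k) → Pointwise _≈ₚ_ p (Vec.map polynomial e) → ∀ s →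
  Vec.map (λ r → eval r (s ℚ./ 1)) p ≡ Vec.map (λ a → a ℚ./ 1) (Vec.map (λ e → ⟦ℤ⟧.⟦ e ⟧ (s ∷ [])) e)
eval-polynomials []      []      []          s = ≡.refl
eval-polynomials (r ∷ p) (e ∷ f) (r≈e ∷ p≈f) s = ≡.cong₂ _∷_
  (≡.trans (eval-cong (s ℚ./ 1) r≈e) (eval-polynomial e s)) (eval-polynomials p f p≈f s)

-- The integer witness is the tuple of term values at `s` in ℤ, available because the terms have
-- integer coefficients.
polynomials-areBüchi : ∀ n p → Pointwise _≈ₚ_ p (Vec.map polynomial (Terms.x n)) → ∀ s → ∃ λ x →
  (Vec.map (λ r → eval r (s ℚ./ 1)) p ≡ Vec.map (λ a → a ℚ./ 1) x) × Büchi.IsBüchi +-*-commutativeRing x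
polynomials-areBüchi n p p≈ s = at (SpanProperties.terms-areBüchi +-*-commutativeRing s n)
  where
  at : (∃ λ x → x ≡ Vec.map (λ e → ⟦ℤ⟧.⟦ e ⟧ (s ∷ [])) (Terms.x n) × Büchi.IsBüchi +-*-commutativeRing x) →
    ∃ λ x → (Vec.map (λ r → eval r (s ℚ./ 1)) p ≡ Vec.map (λ a → a ℚ./ 1) x) × Büchi.IsBüchi +-*-commutativeRing x
  at (x , x≡ , isBüchi) = x ,
    ≡.trans (eval-polynomials p (Terms.x n) p≈ s) (≡.cong (Vec.map (λ a → a ℚ./ 1)) (≡.sym x≡)) , isBüchi

ξ-unique : ∀ n p → IsPolyTuple (ξ n) p → Pointwise _≈ₚ_ p (Vec.map polynomial (Terms.x n))
ξ-unique n (r₁ ∷ r₂ ∷ r₃ ∷ r₄ ∷ []) (ξ₁≈r₁ ∷ ξ₂≈r₂ ∷ ξ₃≈r₃ ∷ ξ₄≈r₄ ∷ []) =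
  polynomial-unique ξ₁ Terms.x₁ ξ₁≈ n r₁ ξ₁≈r₁ ∷ polynomial-unique ξ₂ Terms.x₂ ξ₂≈ n r₂ ξ₂≈r₂ ∷
  polynomial-unique ξ₃ Terms.x₃ ξ₃≈ n r₃ ξ₃≈r₃ ∷ polynomial-unique ξ₄ Terms.x₄ ξ₄≈ n r₄ ξ₄≈r₄ ∷ []

-- `Orbit.orbit n` unfolds to the polynomial values of `Terms.x n`, the same terms that describe ξ
-- n; there the iterates meet the closed formulas.
orbit-value : ∀ n P → Pointwise _≈ₖ_ P (Vec.map fromPoly (Orbit.orbit n)) → Vec.map fromK P ≋ ξ n
orbit-value n (a ∷ b ∷ c ∷ d ∷ []) (a≈ ∷ b≈ ∷ c≈ ∷ d≈ ∷ []) =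
  fromK-value ξ₁ Terms.x₁ ξ₁≈ n a a≈ ∷ fromK-value ξ₂ Terms.x₂ ξ₂≈ n b b≈ ∷
  fromK-value ξ₃ Terms.x₃ ξ₃≈ n c c≈ ∷ fromK-value ξ₄ Terms.x₄ ξ₄≈ n d d≈ ∷ []

ξ-polynomial : ∀ n → ∃ λ p → IsPolyTuple (ξ n) p × All (λ r → HasDegree r (2 ℕ.* n ℕ.+ 1)) p
ξ-polynomial n = Vec.map polynomial (Terms.x n) , ξ-polynomials n , polynomials-degree n

ξ-isBüchi : ∀ n (p : Vec ℚ[t] 4) → IsPolyTuple (ξ n) p → (s : ℤ) → ∃ λ (x : Vec ℤ 4) →
  (Vec.map (λ r → eval r (s ℚ./ 1)) p ≡ Vec.map (λ a → a ℚ./ 1) x) × Büchi.IsBüchi +-*-commutativeRing x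
ξ-isBüchi n p ξ≈p = polynomials-areBüchi n p (ξ-unique n p ξ≈p)

ζ-iterate : ∀ n → Σ (Dom (iterate ζ n) P₀) λ h →
  X₄ (apply (iterate ζ n) P₀ h) × (Vec.map fromK (apply (iterate ζ n) P₀ h) ≋ ξ n)
ζ-iterate n = at (Orbit.iterate-orbit n)
  where
  at : (Σ (Dom (iterate ζ n) P₀) λ h → Pointwise _≈ₖ_ (apply (iterate ζ n) P₀ h) (Vec.map fromPoly (Orbit.orbit n))) →
    Σ (Dom (iterate ζ n) P₀) λ h →
      X₄ (apply (iterate ζ n) P₀ h) × (Vec.map fromK (apply (iterate ζ n) P₀ h) ≋ ξ n)
  at (h , P≈) = h , Orbit.orbit∈X₄ n (apply (iterate ζ n) P₀ h) P≈ , orbit-value n (apply (iterate ζ n) P₀ h) P≈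

theorem3p2 : (ξ 0 ≋ t + # 1 ∷ t + # 2 ∷ t + # 3 ∷ t + # 4 ∷ [])
    × (ξ 1 ≋ # 2 * t ^ 3 + # 12 * t ^ 2 + # 19 * t + # 6
    ∷ # 2 * t ^ 3 + # 14 * t ^ 2 + # 31 * t + # 23
    ∷ # 2 * t ^ 3 + # 16 * t ^ 2 + # 41 * t + # 32
    ∷ # 2 * t ^ 3 + # 18 * t ^ 2 + # 49 * t + # 39
    ∷ [])
    × ((n : ℕ) →
    ξ (2 ℕ.+ n) ≋
    Vec.zipWith (λ x y → (# 2 * t ^ 2 + # 10 * t + # 10) * x - y) (ξ (suc n)) (ξ n))
    × ((n : ℕ) →
    ∃ λ p → IsPolyTuple (ξ n) p × All (λ r → HasDegree r (2 ℕ.* n ℕ.+ 1)) p)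
    × ((n : ℕ) (p : Vec ℚ[t] 4) → IsPolyTuple (ξ n) p → (s : ℤ) →
    ∃ λ (x : Vec ℤ 4) →
    (Vec.map (λ r → eval r (s ℚ./ 1)) p ≡ Vec.map (λ a → a ℚ./ 1) x)
    × Büchi.IsBüchi +-*-commutativeRing x)
    × ((n : ℕ) →
    Σ (Dom (iterate ζ n) P₀) λ h →
    X₄ (apply (iterate ζ n) P₀ h)
    × (Vec.map fromK (apply (iterate ζ n) P₀ h) ≋ ξ n))
theorem3p2 = ξ-zero , ξ-one , ξ-recurrence , ξ-polynomial , ξ-isBüchi , ζ-iterate
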